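{- Let $G=(V,w,\mu,d)$ be a finite connected weighted graph equipped with a general path distance $d$, and suppose $G$ has non-negative Ollivier curvature. Suppose there exists a vertex $x\in V$ such that $\kappa(x,y)>0$ for all $y\in S_1^{comb}(x)$. Then $\beta_1(M_2(G))=0$.
   Context: A finite weighted graph $G=(V,w,\mu,d)$ consists of a finite vertex set $V$, a symmetric edge weight $w:V\times V\to[0,\infty)$ vanishing on the diagonal, a vertex weight $\mu:V\to(0,\infty)$, and a general path distance $d$. Write $x\sim y$ iff $w(x,y)>0$; $G$ is connected. A general path distance is a symmetric $d:V\times V\to[0,\infty)$ with $d(x,y)=0$ iff $x=y$ and $d(x,y)=\inf\{\sum_{k=1}^n d(x_{k-1},x_k): x=x_0\sim x_1\sim\dots\sim x_n=y\}$ for all $x,y$. $S_1^{comb}(x)=\{y: y\sim x\}$. The Laplacian is $\Delta f(x)=\sum_{y}\frac{w(x,y)}{\mu(x)}(f(y)-f(x))$. For $x\neq y$ let $\nabla_{xy}f=\frac{f(x)-f(y)}{d(x,y)}$ and $\|\nabla f\|_\infty=\sup_{x\neq y}|\nabla_{xy}f|$. The Ollivier curvature of distinct vertices $x,y$ is $\kappa(x,y)=\inf\{\nabla_{xy}\Delta f: f:V\to\mathbb R,\ \nabla_{yx}f=1,\ \|\nabla f\|_\infty=1\}$; $G$ has non-negative Ollivier curvature if $\kappa(x,y)\ge 0$ for all $x\sim y$. The complex $M_2(G)$: a 1-form is a function $\alpha$ on ordered pairs of adjacent vertices with $\alpha(y,x)=-\alpha(x,y)$. A cycle is a sequence $(x_0\sim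 x_1\sim\dots\sim x_{n-1})$ of distinct vertices with $n\ge 3$ and $x_{n-1}\sim x_0$, considered up to cyclic rotation and reversal. $X_2$ is the set of cycles admitting a labeling $(x_0\sim\dots\sim x_{n-1})$ such that either $n=3$, or $d(x_0,x_3)<d(x_0,x_1)+d(x_1,x_2)+d(x_2,x_3)$ and the path $x_3\sim x_4\sim\dots\sim x_{n-1}\sim x_0$ is a geodesic (the sum of $d$ along consecutive vertices equals $d(x_3,x_0)$). For a 1-form $\alpha$ set $\delta\alpha(c)=\sum_{i=0}^{n-1}\alpha(x_i,x_{i+1 \bmod n})$ for $c=(x_0\sim\dots\sim x_{n-1})\in X_2$, and $\delta^*\alpha(x)=\sum_{y\sim x}\frac{w(x,y)}{\mu(x)}\alpha(x,y)$. Then $H_1(M_2(G))=\{\alpha: \delta\alpha(c)=0\ \forall c\in X_2,\ \delta^*\alpha\equiv 0\}$ and $\beta_1(M_2(G))=\dim H_1(M_2(G))$. -}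

module Defs where

open import Data.Nat using (ℕ; zero; suc)
open import Data.Fin using (Fin)
open import Data.List using (List; []; _∷_; _++_; [_]; length; zip)
open import Data.List.Relation.Unary.All using (All)
open import Data.List.Relation.Unary.Unique.Propositional using (Unique)
open import Data.Product using (Σ; ∃; _×_; _,_)
open import Data.Sum using (_⊎_)
open import Data.Unit using (⊤)
open import Data.Empty using (⊥)
open import Relation.Nullary using (¬_)
open import Relation.Binary.PropositionalEquality using (_≡_)
open import Relation.Binary.Structures using (IsStrictTotalOrder)
open import Relation.Binary.Definitions using (tri<; tri≈; tri>)
open import Algebra.Structures using (IsCommutativeRing)

-- The real numbers, axiomatised as a complete ordered field
-- (any two such are isomorphic, so this pins down ℝ).
-- The inverse is total; its value at 0 is unconstrained and never used.

record RealField : Set₁ where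
  infixl 6 _+_
  infixl 7 _*_
  infix 4 _<_
  field
    R : Set
    0# 1# : R
    _+_ _*_ : R → R → R
    -_ : R → R
    _⁻¹ : R → R
    _<_ : R → R → Set
    isCommutativeRing : IsCommutativeRing _≡_ _+_ _*_ -_ 0# 1#
    0≢1 : ¬ (0# ≡ 1#)
    ⁻¹-inverse : ∀ x → ¬ (x ≡ 0#) → x * (x ⁻¹) ≡ 1#
    isStrictTotalOrder : IsStrictTotalOrder _≡_ _<_
    +-mono-< : ∀ {x y} z → x < y → x + z < y + z
    *-pos : ∀ {x y} → 0# < x → 0# < y → 0# < x * y
    lub : (P : R → Set) → ∃ P →
          ∃ (λ b → ∀ x → P x → (x < b ⊎ x ≡ b)) →
          ∃ (λ s → (∀ x → P x → (x < s ⊎ x ≡ s)) ×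
                   (∀ b → (∀ x → P x → (x < b ⊎ x ≡ b)) → (s < b ⊎ s ≡ b)))

module _ (RF : RealField) where
  open RealField RF
  open IsStrictTotalOrder isStrictTotalOrder using (compare)

  infix 4 _≤_
  _≤_ : R → R → Set
  x ≤ y = x < y ⊎ x ≡ y

  _-_ : R → R → R
  x - y = x + (- y)

  _/_ : R → R → R
  x / y = x * (y ⁻¹)

  abs : R → R
  abs x with compare x 0#
  ... | tri< _ _ _ = - x
  ... | tri≈ _ _ _ = x
  ... | tri> _ _ _ = x

  sumFin : (n : ℕ) → (Fin n → R) → R
  sumFin zero    f = 0#
  sumFin (suc n) f = f Fin.zero + sumFin n (λ i → f (Fin.suc i))

  sumList : List R → R
  sumList []       = 0#
  sumList (a ∷ as) = a + sumList as

  record WGraph (n : ℕ) : Set where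
    field
      w : Fin n → Fin n → R
      μ : Fin n → R
      d : Fin n → Fin n → R

  module _ {n : ℕ} (G : WGraph n) where
    open WGraph G

    Adj : Fin n → Fin n → Set
    Adj x y = 0# < w x y

    data Walk : Fin n → Fin n → Set where
      [] : ∀ {x} → Walk x x
      _∷_ : ∀ {x z y} → Adj x z → Walk z y → Walk x y

    walkLen : ∀ {x y} → Walk x y → R
    walkLen [] = 0#
    walkLen (_∷_ {x} {z} _ p) = d x z + walkLen p

    record IsPathDistance : Set where
      field
        d-sym  : ∀ x y → d x y ≡ d y x
        d-nonneg : ∀ x y → 0# ≤ d x y
        d-zero : ∀ x y → d x y ≡ 0# → x ≡ y
        d-refl : ∀ x → d x x ≡ 0#
        d-lower : ∀ x y (p : Walk x y) → d x y ≤ walkLen p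
        d-approx : ∀ x y ε → 0# < ε → Σ (Walk x y) (λ p → walkLen p < d x y + ε)

    record IsWeightedGraph : Set where
      field
        w-sym : ∀ x y → w x y ≡ w y x
        w-nonneg : ∀ x y → 0# ≤ w x y
        w-diag : ∀ x → w x x ≡ 0#
        μ-pos : ∀ x → 0# < μ x
        pathDistance : IsPathDistance

    Connected : Set
    Connected = ∀ x y → Walk x y

    Δ : (Fin n → R) → Fin n → R
    Δ f x = sumFin n (λ y → (w x y / μ x) * (f y - f x))

    ∇ : Fin n → Fin n → (Fin n → R) → R
    ∇ x y f = (f x - f y) / d x y

    SupNormGradOne : (Fin n → R) → Set
    SupNormGradOne f =
      (∀ a b → ¬ (a ≡ b) → abs (∇ a b f) ≤ 1#) ×
      (∀ u → (∀ a b → ¬ (a ≡ b) → abs (∇ a b f) ≤ u) → 1# ≤ u)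

    Admissible : Fin n → Fin n → (Fin n → R) → Set
    Admissible x y f = (∇ y x f ≡ 1#) × SupNormGradOne f

    -- κ(x,y) ≥ c, i.e. c is a lower bound of
    -- { ∇_{xy} Δ f : ∇_{yx} f = 1, ‖∇ f‖∞ = 1 }
    CurvatureAtLeast : Fin n → Fin n → R → Set
    CurvatureAtLeast x y c = ∀ f → Admissible x y f → c ≤ ∇ x y (Δ f)

    CurvaturePositive : Fin n → Fin n → Set
    CurvaturePositive x y = ∃ λ ε → (0# < ε) × CurvatureAtLeast x y ε

    NonNegOllivier : Set
    NonNegOllivier = ∀ x y → Adj x y → CurvatureAtLeast x y 0#

    -- a 1-form: values on adjacent ordered pairs (values on non-adjacent
    -- pairs are irrelevant), antisymmetric
    OneForm : (Fin n → Fin n → R) → Set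
    OneForm α = ∀ x y → Adj x y → α y x ≡ - (α x y)

    cycPairs : List (Fin n) → List (Fin n × Fin n)
    cycPairs [] = []
    cycPairs (x₀ ∷ xs) = zip (x₀ ∷ xs) (xs ++ [ x₀ ])

    AdjPair : Fin n × Fin n → Set
    AdjPair (a , b) = Adj a b

    IsCycleLabeling : List (Fin n) → Set
    IsCycleLabeling xs = (3 ≤ℕ length xs) × Unique xs × All AdjPair (cycPairs xs)
      where
        _≤ℕ_ : ℕ → ℕ → Set
        m ≤ℕ k = Data.Nat._≤_ m k

    pathLen : List (Fin n) → R
    pathLen (a ∷ b ∷ t) = d a b + pathLen (b ∷ t)
    pathLen _ = 0#

    -- the labeling witnesses membership in X₂
    X₂Labeling : List (Fin n) → Set
    X₂Labeling (x₀ ∷ x₁ ∷ x₂ ∷ []) = ⊤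
    X₂Labeling (x₀ ∷ x₁ ∷ x₂ ∷ x₃ ∷ rest) =
      (d x₀ x₃ < d x₀ x₁ + d x₁ x₂ + d x₂ x₃) ×
      (pathLen (x₃ ∷ rest ++ [ x₀ ]) ≡ d x₃ x₀)
    X₂Labeling _ = ⊥

    δ : (Fin n → Fin n → R) → List (Fin n) → R
    δ α xs = sumList (Data.List.map (λ { (a , b) → α a b }) (cycPairs xs))

    δ* : (Fin n → Fin n → R) → Fin n → R
    δ* α x = sumFin n (λ y → (w x y / μ x) * α x y)

    InH₁ : (Fin n → Fin n → R) → Set
    InH₁ α = OneForm α ×
             (∀ xs → IsCycleLabeling xs → X₂Labeling xs → δ α xs ≡ 0#) ×
             (∀ x → δ* α x ≡ 0#)

    BettiOneZero : Set
    BettiOneZero = ∀ α → InH₁ α → ∀ x y → Adj x y → α x y ≡ 0#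

{-# OPTIONS --safe #-}

-- Let s be the maximum of α(a,b)/d(a,b) over the edges and suppose s > 0; call the edges
-- where it is attained extremal. Since δα vanishes on X₂, a walk of at most three edges has
-- the same α-integral as some geodesic, so α has an s-Lipschitz potential F on the union of
-- the unit balls around an edge x ∼ y, and F has slope s only along extremal walks. Both
-- Laplacians ΔF(x) and ΔF(y) vanish, so κ(x,y) > 0 excludes that (x,y) is extremal. Otherwise
-- perturb F to F + εg: if g(a) − g(b) ≥ c d(a,b) on extremal edges, with equality on (x,y),
-- then κ(x,y) ≥ 0 forces Δg(x) ≥ Δg(y). Suitable g show that the set of vertices at which no
-- infinite extremal path starts is closed under adjacency, and that it is not everything. Hence
-- every vertex, in particular the one with positive curvature, is the start of an extremal edge.

module Submission where

open import Defs hiding (_≤_; _-_; _/_; abs)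
open import Data.Nat using (ℕ)
open import Data.Fin using (Fin)
open import Data.Empty using (⊥; ⊥-elim)
open import Data.Fin using (zero; suc; combine; remQuot)
import Data.Fin.Properties as Fin
open import Data.Fin.Induction using (spo-wellFounded)
open import Data.Integer as ℤ using (ℤ; 0ℤ; 1ℤ; _⊖_; _◃_)
import Data.Integer.Properties as ℤP
import Data.List.Membership.DecPropositional as Membership
open import Data.List using (List; []; _∷_; _++_; [_]; map; zip; length)
open import Data.List.Relation.Unary.All as All using (All; []; _∷_)
open import Data.List.Relation.Unary.All.Properties using (¬Any⇒All¬)
open import Data.List.Relation.Unary.AllPairs using ([]; _∷_)
open import Data.List.Relation.Unary.Unique.Propositional using (Unique)
open import Data.Maybe using (Maybe; just; nothing)
open import Data.Nat as ℕ using (zero; suc; z≤n; s≤s)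
import Data.Nat.Properties as ℕP
open import Data.Product using (∃; _×_; _,_; proj₁; proj₂)
import Data.Sign as Sign
open import Data.Sum using (_⊎_; inj₁; inj₂)
open import Data.Unit using (⊤; tt)
open import Algebra.Bundles using (CommutativeRing)
import Algebra.Properties.Ring as RingProperties
import Algebra.Properties.Semiring.Mult.TCOptimised as Multiples
import Algebra.Solver.Ring as RingSolver
open import Algebra.Solver.Ring.AlmostCommutativeRing
  using (AlmostCommutativeRing; fromCommutativeRing; _-Raw-AlmostCommutative⟶_)
open import Effect.Monad using (module RawMonad)
open import Function using (_∘_)
open import Induction.WellFounded using (WellFounded; WfRec; Acc; acc; module FixPoint)
import Induction.WellFounded as WF
open import Level using (0ℓ)
open import Relation.Binary.Definitions using (tri<; tri≈; tri>)
open import Relation.Binary.PropositionalEquality hiding ([_])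
import Relation.Binary.Construct.StrictToNonStrict as StrictToNonStrict
open import Relation.Binary.Structures using (IsStrictTotalOrder)
open import Relation.Nullary using (¬_; Dec; yes; no)
open import Relation.Nullary.Decidable using (_×-dec_; _⊎-dec_; ¬?; ¬¬-excluded-middle; decidable-stable)
open import Relation.Nullary.Negation using (¬¬-Monad)
open import Relation.Unary using (Decidable)

-- A form in H₁ need not be exact a priori, and extremal edges might close up into cycles, along
-- which no potential exists. Hence only a potential near one edge is used. That suffices for
-- curvature: the Laplacians at the two ends see only their neighbours, and a Lipschitz function on
-- part of the graph extends to all of it with the same constant. Two vertices near the edge are
-- joined through it by at most three steps, the length of detour that X₂ controls. Cycles also
-- obstruct the natural test function, the length of a longest extremal path, which makes sense only
-- if extremal paths terminate. So infinite extremal paths are treated first, with minus the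
-- indicator of a set of terminating vertices as test function. By induction along extremal edges,
-- if a terminating vertex z is adjacent to a vertex of such a path, curvature makes z adjacent to
-- the next one too, and the triangles with apex z make α(z,·) increase strictly, which cannot go on
-- in a finite graph.

-- Arithmetic and order in the axiomatised reals.

module OrderedField (RF : RealField) where

  open RealField RF public
  open IsStrictTotalOrder isStrictTotalOrder public
    using (compare; _<?_; _≟_) renaming (trans to <-trans; irrefl to <-irrefl)

  infix 4 _≤_
  infixl 6 _-_
  _≤_ : R → R → Set
  _≤_ = Defs._≤_ RF
  _-_ : R → R → R
  _-_ = Defs._-_ RF
  _/_ : R → R → R
  _/_ = Defs._/_ RF

  commutativeRing : CommutativeRing 0ℓ 0ℓ
  commutativeRing = record { isCommutativeRing = isCommutativeRing }

  open CommutativeRing commutativeRing public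
    using (+-comm; +-assoc; +-identityˡ; +-identityʳ; -‿inverseʳ; *-comm; *-assoc;
           *-identityˡ; *-identityʳ; distribˡ; zeroˡ; zeroʳ; ring; semiring)
  open RingProperties ring public
    using (-0#≈0#; -‿distribˡ-*; -‿distribʳ-*; -‿involutive; -‿+-comm)
  open Multiples semiring using (×1-homo-*; ×-homo-+) renaming (_×_ to _×′_)

  almostCommutativeRing : AlmostCommutativeRing 0ℓ 0ℓ
  almostCommutativeRing = fromCommutativeRing commutativeRing

  fromℤ : ℤ → R
  fromℤ (ℤ.+ n)      = n ×′ 1#
  fromℤ (ℤ.-[1+ n ]) = - (suc n ×′ 1#)

  suc×′1 : ∀ n → suc n ×′ 1# ≡ 1# + n ×′ 1#
  suc×′1 n = ×-homo-+ 1# 1 n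

  fromℤ-⊖ : ∀ m n → fromℤ (m ⊖ n) ≡ m ×′ 1# - n ×′ 1#
  fromℤ-⊖ m zero = sym (trans (cong (λ t → m ×′ 1# + t) -0#≈0#) (+-identityʳ _))
  fromℤ-⊖ zero (suc n) = sym (+-identityˡ _)
  fromℤ-⊖ (suc m) (suc n) = begin
    fromℤ (suc m ⊖ suc n)                       ≡⟨ cong fromℤ (ℤP.[1+m]⊖[1+n]≡m⊖n m n) ⟩
    fromℤ (m ⊖ n)                               ≡⟨ fromℤ-⊖ m n ⟩
    m ×′ 1# - n ×′ 1#                           ≡⟨ sym (cancel 1# (m ×′ 1#) (n ×′ 1#)) ⟩
    (1# + m ×′ 1#) - (1# + n ×′ 1#)             ≡⟨ sym (cong₂ _-_ (suc×′1 m) (suc×′1 n)) ⟩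
    suc m ×′ 1# - suc n ×′ 1#                   ∎
    where
    open ≡-Reasoning
    cancel : ∀ x a b → (x + a) - (x + b) ≡ a - b
    cancel x a b = begin
      (x + a) + - (x + b)     ≡⟨ cong₂ _+_ (+-comm x a) (sym (-‿+-comm x b)) ⟩
      (a + x) + (- x + - b)   ≡⟨ +-assoc a x _ ⟩
      a + (x + (- x + - b))   ≡⟨ cong (λ t → a + t) (sym (+-assoc x (- x) (- b))) ⟩
      a + ((x + - x) + - b)   ≡⟨ cong (λ t → a + (t + - b)) (-‿inverseʳ x) ⟩
      a + (0# + - b)          ≡⟨ cong (λ t → a + t) (+-identityˡ _) ⟩
      a - b                   ∎

  fromℤ-neg : ∀ i → fromℤ (ℤ.- i) ≡ - fromℤ i
  fromℤ-neg (ℤ.+ zero)  = sym -0#≈0#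
  fromℤ-neg (ℤ.+ suc n) = refl
  fromℤ-neg ℤ.-[1+ n ]  = sym (-‿involutive _)

  fromℤ-+ : ∀ i j → fromℤ (i ℤ.+ j) ≡ fromℤ i + fromℤ j
  fromℤ-+ (ℤ.+ m) (ℤ.+ n) = ×-homo-+ 1# m n
  fromℤ-+ (ℤ.+ m) ℤ.-[1+ n ] = fromℤ-⊖ m (suc n)
  fromℤ-+ ℤ.-[1+ m ] (ℤ.+ n) = trans (fromℤ-⊖ n (suc m)) (+-comm _ _)
  fromℤ-+ ℤ.-[1+ m ] ℤ.-[1+ n ] = begin
    - (suc (suc (m ℕ.+ n)) ×′ 1#)        ≡⟨ cong (λ t → - (suc t ×′ 1#)) (sym (ℕP.+-suc m n)) ⟩
    - ((suc m ℕ.+ suc n) ×′ 1#)          ≡⟨ cong -_ (×-homo-+ 1# (suc m) (suc n)) ⟩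
    - (suc m ×′ 1# + suc n ×′ 1#)        ≡⟨ sym (-‿+-comm _ _) ⟩
    - (suc m ×′ 1#) + - (suc n ×′ 1#)    ∎
    where
    open ≡-Reasoning

  fromℤ-◃ : ∀ n → fromℤ (Sign.- ◃ n) ≡ - (n ×′ 1#)
  fromℤ-◃ zero = sym -0#≈0#
  fromℤ-◃ (suc n) = refl

  fromℤ-* : ∀ i j → fromℤ (i ℤ.* j) ≡ fromℤ i * fromℤ j
  fromℤ-* (ℤ.+ m) (ℤ.+ n) = trans (cong fromℤ (ℤP.+◃n≡+n (m ℕ.* n))) (×1-homo-* m n)
  fromℤ-* (ℤ.+ m) ℤ.-[1+ n ] =
    trans (fromℤ-◃ (m ℕ.* suc n)) (trans (cong -_ (×1-homo-* m (suc n))) (-‿distribʳ-* _ _))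
  fromℤ-* ℤ.-[1+ m ] (ℤ.+ n) =
    trans (fromℤ-◃ (suc m ℕ.* n)) (trans (cong -_ (×1-homo-* (suc m) n)) (-‿distribˡ-* _ _))
  fromℤ-* ℤ.-[1+ m ] ℤ.-[1+ n ] = begin
    (suc m ℕ.* suc n) ×′ 1#              ≡⟨ ×1-homo-* (suc m) (suc n) ⟩
    suc m ×′ 1# * suc n ×′ 1#            ≡⟨ sym (-‿involutive _) ⟩
    - - (suc m ×′ 1# * suc n ×′ 1#)      ≡⟨ cong -_ (-‿distribʳ-* _ _) ⟩
    - (suc m ×′ 1# * - (suc n ×′ 1#))    ≡⟨ -‿distribˡ-* _ _ ⟩
    - (suc m ×′ 1#) * - (suc n ×′ 1#)    ∎
    where open ≡-Reasoning

  ℤ-morphism : ℤ.+-*-rawRing -Raw-AlmostCommutative⟶ almostCommutativeRing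
  ℤ-morphism = record
    { ⟦_⟧ = fromℤ ; +-homo = fromℤ-+ ; *-homo = fromℤ-* ; -‿homo = fromℤ-neg
    ; 0-homo = refl ; 1-homo = refl }

  -- Integer coefficients give the ring solver an equality test that computes, unlike that of the
  -- abstract field. Only positive answers carry a claim.
  fromℤ-≟ : ∀ i j → Maybe (fromℤ i ≡ fromℤ j)
  fromℤ-≟ i j with i ℤ.≟ j
  ... | yes eq = just (cong fromℤ eq)
  ... | no _   = nothing

  open RingSolver ℤ.+-*-rawRing almostCommutativeRing ℤ-morphism fromℤ-≟ public
    using (solve; _:=_; _:+_; _:*_; :-_; _:-_; con)

  private
    module STO = IsStrictTotalOrder isStrictTotalOrder
    module NonStrict = StrictToNonStrict _≡_ _<_

  abs : R → R
  abs = Defs.abs RF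

  ≤-refl : ∀ {x} → x ≤ x
  ≤-refl = inj₂ refl

  ≤-reflexive : ∀ {x y} → x ≡ y → x ≤ y
  ≤-reflexive = inj₂

  <-≤-trans : ∀ {x y z} → x < y → y ≤ z → x < z
  <-≤-trans = NonStrict.<-≤-trans <-trans (proj₁ STO.<-resp-≈)

  ≤-<-trans : ∀ {x y z} → x ≤ y → y < z → x < z
  ≤-<-trans = NonStrict.≤-<-trans sym <-trans (proj₂ STO.<-resp-≈)

  ≤-trans : ∀ {x y z} → x ≤ y → y ≤ z → x ≤ z
  ≤-trans = NonStrict.trans isEquivalence STO.<-resp-≈ <-trans

  ≤-antisym : ∀ {x y} → x ≤ y → y ≤ x → x ≡ y
  ≤-antisym = NonStrict.antisym isEquivalence <-trans <-irrefl

  ≤⇒≯ : ∀ {x y} → x ≤ y → ¬ (y < x)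
  ≤⇒≯ x≤y y<x = <-irrefl refl (≤-<-trans x≤y y<x)

  ≮⇒≥ : ∀ {x y} → ¬ (x < y) → y ≤ x
  ≮⇒≥ {x} {y} x≮y with compare x y
  ... | tri< x<y _ _ = ⊥-elim (x≮y x<y)
  ... | tri≈ _ x≡y _ = inj₂ (sym x≡y)
  ... | tri> _ _ y<x = inj₁ y<x

  ≰⇒> : ∀ {x y} → ¬ (x ≤ y) → y < x
  ≰⇒> {x} {y} x≰y with compare x y
  ... | tri< x<y _ _ = ⊥-elim (x≰y (inj₁ x<y))
  ... | tri≈ _ x≡y _ = ⊥-elim (x≰y (inj₂ x≡y))
  ... | tri> _ _ y<x = y<x

  _≤?_ : ∀ x y → Dec (x ≤ y)
  x ≤? y with y <? x
  ... | yes y<x = no (λ x≤y → ≤⇒≯ x≤y y<x)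
  ... | no y≮x  = yes (≮⇒≥ y≮x)

  diff-pos : ∀ {x y} → x < y → 0# < y - x
  diff-pos {x} {y} x<y = subst (_< y - x) (-‿inverseʳ x) (+-mono-< (- x) x<y)

  diff-nonneg : ∀ {x y} → x ≤ y → 0# ≤ y - x
  diff-nonneg (inj₁ x<y) = inj₁ (diff-pos x<y)
  diff-nonneg {x} (inj₂ refl) = inj₂ (sym (-‿inverseʳ x))

  -- Linear inequalities are proved by exhibiting the difference of the two sides
  -- as an expression that is visibly positive or nonnegative.
  <-from-diff : ∀ {x y e} → 0# < e → e ≡ y - x → x < y
  <-from-diff {x} {y} 0<e refl =
    subst₂ _<_ (+-identityˡ x) (solve 2 (λ x y → y :- x :+ x := y) refl x y) (+-mono-< x 0<e)

  ≤-from-diff : ∀ {x y e} → 0# ≤ e → e ≡ y - x → x ≤ y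
  ≤-from-diff (inj₁ 0<e) eq = inj₁ (<-from-diff 0<e eq)
  ≤-from-diff {x} {y} (inj₂ refl) eq = inj₂ (sym (begin
    y            ≡⟨ solve 2 (λ x y → y := y :- x :+ x) refl x y ⟩
    y - x + x    ≡⟨ cong (_+ x) (sym eq) ⟩
    0# + x       ≡⟨ +-identityˡ x ⟩
    x            ∎))
    where open ≡-Reasoning

  +-mono-≤ : ∀ {a b c d} → a ≤ b → c ≤ d → a + c ≤ b + d
  +-mono-≤ {a} {b} {c} {d} a≤b c≤d = ≤-trans (step c a≤b) (subst₂ _≤_ (+-comm c b) (+-comm d b) (step b c≤d))
    where
    step : ∀ {x y} z → x ≤ y → x + z ≤ y + z
    step z (inj₁ x<y)  = inj₁ (+-mono-< z x<y)
    step z (inj₂ refl) = ≤-refl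

  +-mono-<-≤ : ∀ {a b c d} → a < b → c ≤ d → a + c < b + d
  +-mono-<-≤ {b = b} {c} a<b c≤d = <-≤-trans (+-mono-< c a<b) (+-mono-≤ (≤-refl {b}) c≤d)

  +-mono-≤-< : ∀ {a b c d} → a ≤ b → c < d → a + c < b + d
  +-mono-≤-< {a} {b} {c} {d} a≤b c<d = subst₂ _<_ (+-comm c a) (+-comm d b) (+-mono-<-≤ c<d a≤b)

  0≤+ : ∀ {x y} → 0# ≤ x → 0# ≤ y → 0# ≤ x + y
  0≤+ {x} {y} 0≤x 0≤y = subst (_≤ x + y) (+-identityˡ 0#) (+-mono-≤ 0≤x 0≤y)

  0<+ : ∀ {x y} → 0# < x → 0# ≤ y → 0# < x + y
  0<+ {x} {y} 0<x 0≤y = subst (_< x + y) (+-identityˡ 0#) (+-mono-<-≤ 0<x 0≤y)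

  0≤* : ∀ {x y} → 0# ≤ x → 0# ≤ y → 0# ≤ x * y
  0≤* (inj₁ 0<x) (inj₁ 0<y)      = inj₁ (*-pos 0<x 0<y)
  0≤* {x} (inj₁ _) (inj₂ refl)   = inj₂ (sym (zeroʳ x))
  0≤* {y = y} (inj₂ refl) _      = inj₂ (sym (zeroˡ y))

  *-monoˡ-≤ : ∀ {x y} z → 0# ≤ z → x ≤ y → z * x ≤ z * y
  *-monoˡ-≤ {x} {y} z 0≤z x≤y = ≤-from-diff (0≤* 0≤z (diff-nonneg x≤y))
    (solve 3 (λ x y z → z :* (y :- x) := z :* y :- z :* x) refl x y z)

  *-monoˡ-< : ∀ {x y} z → 0# < z → x < y → z * x < z * y
  *-monoˡ-< {x} {y} z 0<z x<y = <-from-diff (*-pos 0<z (diff-pos x<y))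
    (solve 3 (λ x y z → z :* (y :- x) := z :* y :- z :* x) refl x y z)

  *-cancelˡ-≤ : ∀ {x y} z → 0# < z → z * x ≤ z * y → x ≤ y
  *-cancelˡ-≤ z 0<z zx≤zy = ≮⇒≥ (λ y<x → ≤⇒≯ zx≤zy (*-monoˡ-< z 0<z y<x))

  neg-≤ : ∀ {x y} → x ≤ y → - y ≤ - x
  neg-≤ {x} {y} x≤y = ≤-from-diff (diff-nonneg x≤y) (solve 2 (λ x y → y :- x := :- x :- (:- y)) refl x y)

  neg-< : ∀ {x} → x < 0# → 0# < - x
  neg-< {x} x<0 = subst (0# <_) (+-identityˡ (- x)) (diff-pos x<0)

  0<1 : 0# < 1#
  0<1 with compare 0# 1#
  ... | tri< 0<1 _ _ = 0<1
  ... | tri≈ _ 0≡1 _ = ⊥-elim (0≢1 0≡1)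
  ... | tri> _ _ 1<0 = subst (0# <_) (solve 0 (:- con 1ℤ :* :- con 1ℤ := con 1ℤ) refl)
                         (*-pos (neg-< 1<0) (neg-< 1<0))

  >⇒≢0 : ∀ {x} → 0# < x → ¬ (x ≡ 0#)
  >⇒≢0 0<x x≡0 = <-irrefl (sym x≡0) 0<x

  ⁻¹-pos : ∀ {x} → 0# < x → 0# < x ⁻¹
  ⁻¹-pos {x} 0<x with compare 0# (x ⁻¹)
  ... | tri< 0<x⁻¹ _ _ = 0<x⁻¹
  ... | tri≈ _ 0≡x⁻¹ _ = ⊥-elim (0≢1 (begin
    0#         ≡⟨ sym (zeroʳ x) ⟩
    x * 0#     ≡⟨ cong (x *_) 0≡x⁻¹ ⟩
    x * x ⁻¹   ≡⟨ ⁻¹-inverse x (>⇒≢0 0<x) ⟩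
    1#         ∎))
    where open ≡-Reasoning
  ... | tri> _ _ x⁻¹<0 = ⊥-elim (<-irrefl refl (<-trans 0<1
    (<-from-diff (*-pos 0<x (neg-< x⁻¹<0))
      (trans (solve 2 (λ x y → x :* (:- y) := con 0ℤ :- x :* y) refl x (x ⁻¹))
             (cong (λ t → 0# - t) (⁻¹-inverse x (>⇒≢0 0<x)))))))

  /-* : ∀ x {y} → 0# < y → (x / y) * y ≡ x
  /-* x {y} 0<y = begin
    (x * y ⁻¹) * y   ≡⟨ solve 3 (λ x y z → (x :* z) :* y := x :* (y :* z)) refl x y (y ⁻¹) ⟩
    x * (y * y ⁻¹)   ≡⟨ cong (x *_) (⁻¹-inverse y (>⇒≢0 0<y)) ⟩
    x * 1#           ≡⟨ *-identityʳ x ⟩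
    x                ∎
    where open ≡-Reasoning

  /-≤1 : ∀ {x y} → 0# < y → x ≤ y → x / y ≤ 1#
  /-≤1 {x} {y} 0<y x≤y = *-cancelˡ-≤ y 0<y (subst₂ _≤_
    (sym (trans (*-comm y _) (/-* x 0<y))) (sym (*-identityʳ y)) x≤y)

  abs-≤ : ∀ {x u} → x ≤ u → - x ≤ u → abs x ≤ u
  abs-≤ {x} x≤u -x≤u with compare x 0#
  ... | tri< _ _ _ = -x≤u
  ... | tri≈ _ _ _ = x≤u
  ... | tri> _ _ _ = x≤u

  ≤-abs : ∀ x → x ≤ abs x
  ≤-abs x with compare x 0#
  ... | tri< x<0 _ _ = inj₁ (<-trans x<0 (neg-< x<0))
  ... | tri≈ _ _ _ = ≤-refl
  ... | tri> _ _ _ = ≤-refl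

  min : R → R → R
  min x y with x ≤? y
  ... | yes _ = x
  ... | no _  = y

  min-≤ˡ : ∀ x y → min x y ≤ x
  min-≤ˡ x y with x ≤? y
  ... | yes _  = ≤-refl
  ... | no x≰y = inj₁ (≰⇒> x≰y)

  min-≤ʳ : ∀ x y → min x y ≤ y
  min-≤ʳ x y with x ≤? y
  ... | yes x≤y = x≤y
  ... | no _    = ≤-refl

  min-pos : ∀ {x y} → 0# < x → 0# < y → 0# < min x y
  min-pos {x} {y} 0<x 0<y with x ≤? y
  ... | yes _ = 0<x
  ... | no _  = 0<y

  -- Properties of all sufficiently small positive parameters.

  -- The bound `ε` belongs to the range, so it can itself be chosen as the parameter.
  Eventually : (R → Set) → Set
  Eventually Q = ∃ λ ε → 0# < ε × (∀ η → 0# < η → η ≤ ε → Q η)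

  always : ∀ {Q : R → Set} → (∀ η → Q η) → Eventually Q
  always q = 1# , 0<1 , λ η _ _ → q η

  both : ∀ {P Q : R → Set} → Eventually P → Eventually Q → Eventually (λ η → P η × Q η)
  both (ε , 0<ε , p) (ε′ , 0<ε′ , q) = min ε ε′ , min-pos 0<ε 0<ε′ ,
    λ η 0<η η≤ → p η 0<η (≤-trans η≤ (min-≤ˡ ε ε′)) , q η 0<η (≤-trans η≤ (min-≤ʳ ε ε′))

  allFin : ∀ {n} {Q : Fin n → R → Set} → (∀ i → Eventually (Q i)) → Eventually (λ η → ∀ i → Q i η)
  allFin {zero} e = always (λ _ ())
  allFin {suc n} e with both (e zero) (allFin (e ∘ suc))
  ... | ε , 0<ε , q = ε , 0<ε , λ where
    η 0<η η≤ zero    → proj₁ (q η 0<η η≤)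
    η 0<η η≤ (suc i) → proj₂ (q η 0<η η≤) i

  when : ∀ {P : Set} {Q : R → Set} → Dec P → (P → Eventually Q) → Eventually (λ η → P → Q η)
  when (no ¬p) _ = always (λ _ p → ⊥-elim (¬p p))
  when (yes p) q with q p
  ... | ε , 0<ε , q′ = ε , 0<ε , λ η 0<η η≤ _ → q′ η 0<η η≤

  eventually-* : ∀ {D} K → 0# < D → Eventually (λ η → η * K ≤ D)
  eventually-* {D} K 0<D with 0# <? K
  ... | no K≯0 = 1# , 0<1 , λ η 0<η _ →
      ≤-trans (*-monoˡ-≤ η (inj₁ 0<η) (≮⇒≥ K≯0)) (≤-trans (≤-reflexive (zeroʳ η)) (inj₁ 0<D))
  ... | yes 0<K = D / K , *-pos 0<D (⁻¹-pos 0<K) , λ η 0<η η≤ →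
      subst₂ _≤_ (*-comm K η) (trans (*-comm K _) (/-* D 0<K)) (*-monoˡ-≤ K (inj₁ 0<K) η≤)

  -- Extrema and sums over finite index sets.

  argmax : ∀ {n} {P : Fin n → Set} → Decidable P → (f : Fin n → R) → ∃ P →
           ∃ λ i → P i × (∀ j → P j → f j ≤ f i)
  argmax {suc n} {P} P? f (i₀ , p₀) with Fin.any? (P? ∘ suc) | P? zero
  ... | no none | no ¬p₀ = ⊥-elim (absurd i₀ p₀)
    where
    absurd : ∀ i → P i → ⊥
    absurd zero p = ¬p₀ p
    absurd (suc i) p = none (i , p)
  ... | no none | yes p = zero , p , λ where
    zero _ → ≤-refl
    (suc j) q → ⊥-elim (none (j , q))
  ... | yes some | dec with argmax (P? ∘ suc) (f ∘ suc) some
  ...   | i , pᵢ , max with dec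
  ...     | no ¬p₀ = suc i , pᵢ , λ where
              zero q → ⊥-elim (¬p₀ q)
              (suc j) q → max j q
  ...     | yes p with f (suc i) ≤? f zero
  ...       | yes fᵢ≤f₀ = zero , p , λ where
                zero _ → ≤-refl
                (suc j) q → ≤-trans (max j q) fᵢ≤f₀
  ...       | no fᵢ≰f₀ = suc i , pᵢ , λ where
                zero _ → inj₁ (≰⇒> fᵢ≰f₀)
                (suc j) q → max j q

  argmin : ∀ {n} {P : Fin n → Set} → Decidable P → (f : Fin n → R) → ∃ P →
           ∃ λ i → P i × (∀ j → P j → f i ≤ f j)
  argmin P? f some with argmax P? (λ i → - f i) some
  ... | i , p , max = i , p , λ j q →
    subst₂ _≤_ (-‿involutive (f i)) (-‿involutive (f j)) (neg-≤ (max j q))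

  ∑ : ∀ {n} → (Fin n → R) → R
  ∑ {n} = sumFin RF n

  ∑-cong : ∀ {n} {f g : Fin n → R} → (∀ i → f i ≡ g i) → ∑ f ≡ ∑ g
  ∑-cong {zero} eq  = refl
  ∑-cong {suc n} eq = cong₂ _+_ (eq zero) (∑-cong (eq ∘ suc))

  ∑-linear : ∀ {n} c (f g : Fin n → R) → ∑ (λ i → f i + c * g i) ≡ ∑ f + c * ∑ g
  ∑-linear {zero} c f g = solve 1 (λ c → con 0ℤ := con 0ℤ :+ c :* con 0ℤ) refl c
  ∑-linear {suc n} c f g = trans
    (cong (f zero + c * g zero +_) (∑-linear c (f ∘ suc) (g ∘ suc)))
    (solve 5 (λ a b c s t → a :+ c :* b :+ (s :+ c :* t) := a :+ s :+ c :* (b :+ t)) refl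
      (f zero) (g zero) c (∑ (f ∘ suc)) (∑ (g ∘ suc)))

  ∑-scale : ∀ {n} c (f : Fin n → R) → ∑ (λ i → c * f i) ≡ c * ∑ f
  ∑-scale {zero} c f = sym (zeroʳ c)
  ∑-scale {suc n} c f = trans (cong (c * f zero +_) (∑-scale c (f ∘ suc))) (sym (distribˡ c _ _))

  ∑-nonneg : ∀ {n} {f : Fin n → R} → (∀ i → 0# ≤ f i) → 0# ≤ ∑ f
  ∑-nonneg {zero} pos  = ≤-refl
  ∑-nonneg {suc n} pos = 0≤+ (pos zero) (∑-nonneg (pos ∘ suc))

  ∑-nonpos : ∀ {n} {f : Fin n → R} → (∀ i → f i ≤ 0#) → ∑ f ≤ 0#
  ∑-nonpos {zero} neg = ≤-refl
  ∑-nonpos {suc n} {f} neg = subst (∑ f ≤_) (+-identityˡ 0#) (+-mono-≤ (neg zero) (∑-nonpos (neg ∘ suc)))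

  ∑-neg : ∀ {n} {f : Fin n → R} → (∀ i → f i ≤ 0#) → ∀ i → f i < 0# → ∑ f < 0#
  ∑-neg {suc n} {f} neg zero f₀<0 = subst (∑ f <_) (+-identityˡ 0#) (+-mono-<-≤ f₀<0 (∑-nonpos (neg ∘ suc)))
  ∑-neg {suc n} {f} neg (suc i) fᵢ<0 = subst (∑ f <_) (+-identityˡ 0#) (+-mono-≤-< (neg zero) (∑-neg (neg ∘ suc) i fᵢ<0))

  _⊔_ : R → R → R
  x ⊔ y with x ≤? y
  ... | yes _ = y
  ... | no _  = x

  x≤x⊔y : ∀ x y → x ≤ x ⊔ y
  x≤x⊔y x y with x ≤? y
  ... | yes x≤y = x≤y
  ... | no _    = ≤-refl

  y≤x⊔y : ∀ x y → y ≤ x ⊔ y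
  y≤x⊔y x y with x ≤? y
  ... | yes _  = ≤-refl
  ... | no x≰y = inj₁ (≰⇒> x≰y)

  ⊔-sel : ∀ x y → x ⊔ y ≡ x ⊎ x ⊔ y ≡ y
  ⊔-sel x y with x ≤? y
  ... | yes _ = inj₂ refl
  ... | no _  = inj₁ refl

  ⨆ : ∀ {n} → (Fin n → R) → R
  ⨆ {zero} f  = 0#
  ⨆ {suc n} f = f zero ⊔ ⨆ (f ∘ suc)

  ⨆-nonneg : ∀ {n} (f : Fin n → R) → 0# ≤ ⨆ f
  ⨆-nonneg {zero} f  = ≤-refl
  ⨆-nonneg {suc n} f = ≤-trans (⨆-nonneg (f ∘ suc)) (y≤x⊔y _ _)

  ⨆-upper : ∀ {n} (f : Fin n → R) i → f i ≤ ⨆ f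
  ⨆-upper f zero    = x≤x⊔y _ _
  ⨆-upper f (suc i) = ≤-trans (⨆-upper (f ∘ suc) i) (y≤x⊔y _ _)

  ⨆-attained : ∀ {n} (f : Fin n → R) → ⨆ f ≡ 0# ⊎ ∃ λ i → ⨆ f ≡ f i
  ⨆-attained {zero} f = inj₁ refl
  ⨆-attained {suc n} f with ⊔-sel (f zero) (⨆ (f ∘ suc)) | ⨆-attained (f ∘ suc)
  ... | inj₁ eq | _             = inj₂ (zero , eq)
  ... | inj₂ eq | inj₁ eq′      = inj₁ (trans eq eq′)
  ... | inj₂ eq | inj₂ (i , eq′) = inj₂ (suc i , trans eq eq′)

  ⨆-cong : ∀ {n} {f g : Fin n → R} → (∀ i → f i ≡ g i) → ⨆ f ≡ ⨆ g
  ⨆-cong {zero} eq  = refl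
  ⨆-cong {suc n} eq = cong₂ _⊔_ (eq zero) (⨆-cong (eq ∘ suc))

-- Geodesics of a path distance.

module Geometry (RF : RealField) {n : ℕ} (G : WGraph RF n) (isWG : IsWeightedGraph RF G) where

  open OrderedField RF public
  open WGraph G public
  open IsWeightedGraph isWG public
  open IsPathDistance pathDistance public

  Path : Fin n → Fin n → Set
  Path = Walk RF G

  len : ∀ {a b} → Path a b → R
  len = walkLen RF G

  infix 4 _∼_ _∼?_
  _∼_ : Fin n → Fin n → Set
  _∼_ = Adj RF G

  _∼?_ : ∀ a b → Dec (a ∼ b)
  a ∼? b = 0# <? w a b

  ∼-sym : ∀ {a b} → a ∼ b → b ∼ a
  ∼-sym {a} {b} = subst (0# <_) (w-sym a b)

  ∼⇒≢ : ∀ {a b} → a ∼ b → ¬ (a ≡ b)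
  ∼⇒≢ {a} a∼a refl = <-irrefl (sym (w-diag a)) a∼a

  d-pos : ∀ {a b} → ¬ (a ≡ b) → 0# < d a b
  d-pos {a} {b} a≢b with d-nonneg a b
  ... | inj₁ 0<d = 0<d
  ... | inj₂ 0≡d = ⊥-elim (a≢b (d-zero a b (sym 0≡d)))

  infixr 5 _++ₚ_
  _++ₚ_ : ∀ {a b c} → Path a b → Path b c → Path a c
  [] ++ₚ q = q
  (e ∷ p) ++ₚ q = e ∷ (p ++ₚ q)

  len-++ : ∀ {a b c} (p : Path a b) (q : Path b c) → len (p ++ₚ q) ≡ len p + len q
  len-++ [] q = sym (+-identityˡ _)
  len-++ (_∷_ {x} {z} e p) q = trans (cong (d x z +_) (len-++ p q)) (sym (+-assoc _ _ _))

  -- The distance is only an infimum over walks, but there are finitely many first vertices. If each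
  -- of them caused a positive excess, a common lower bound `ε` of the excesses would contradict a
  -- walk shorter than `d x y + ε`.
  first-step : ∀ x y → ¬ (x ≡ y) → ∃ λ z → x ∼ z × d x z + d z y ≤ d x y
  first-step x y x≢y with Fin.any? (λ z → (x ∼? z) ×-dec ((d x z + d z y) ≤? d x y))
  ... | yes found = found
  ... | no none = ⊥-elim (absurd (d-approx x y ε 0<ε))
    where
    gap : ∀ z → Eventually (λ η → x ∼ z → η * 1# ≤ d x z + d z y - d x y)
    gap z = when (x ∼? z) λ x∼z → eventually-* 1# (diff-pos (≰⇒> (λ le → none (z , x∼z , le))))
    gaps = allFin gap
    ε = proj₁ gaps
    0<ε = proj₁ (proj₂ gaps)
    absurd : ¬ (∃ λ p → walkLen RF G {x} {y} p < d x y + ε)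
    absurd ([] , _) = x≢y refl
    absurd (_∷_ {z = z} x∼z p , short) = ≤⇒≯ (≤-trans d+ε≤ (+-mono-≤ (≤-refl {d x z}) (d-lower z y p))) short
      where
      d+ε≤ : d x y + ε ≤ d x z + d z y
      d+ε≤ = ≤-from-diff (diff-nonneg (proj₂ (proj₂ gaps) ε 0<ε ≤-refl z x∼z))
        (solve 3 (λ s d e → s :- d :- e :* con 1ℤ := s :- (d :+ e)) refl (d x z + d z y) (d x y) ε)

  closer-wellFounded : ∀ y → WellFounded (λ u v → d u y < d v y)
  closer-wellFounded y = spo-wellFounded record
    { isEquivalence = isEquivalence
    ; irrefl = λ where refl → <-irrefl refl
    ; trans = <-trans
    ; <-resp-≈ = (λ where refl lt → lt) , (λ where refl lt → lt)
    }

  -- Optimal first steps strictly decrease the distance to `y`, which takes finitely many values, so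
  -- iterating them ends at `y` and the infimum is attained.
  geodesic : ∀ x y → ∃ λ (p : Path x y) → len p ≡ d x y
  geodesic x y = go x (closer-wellFounded y x)
    where
    go : ∀ x → Acc (λ u v → d u y < d v y) x → ∃ λ (p : Path x y) → len p ≡ d x y
    go x (acc rec) with x Fin.≟ y
    ... | yes refl = [] , sym (d-refl x)
    ... | no x≢y with first-step x y x≢y
    ...   | z , x∼z , le with go z (rec (<-from-diff
              (0<+ (d-pos (∼⇒≢ x∼z)) (diff-nonneg le))
              (solve 3 (λ a b c → a :+ (c :- (a :+ b)) := c :- b) refl (d x z) (d z y) (d x y))))
    ...     | p , geo = x∼z ∷ p , ≤-antisym
              (≤-trans (≤-reflexive (cong (d x z +_) geo)) le) (d-lower x y (x∼z ∷ p))

  -- Not an axiom of a path distance here; it comes from concatenating geodesics.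
  triangle : ∀ x y z → d x z ≤ d x y + d y z
  triangle x y z with geodesic x y | geodesic y z
  ... | p , p-geo | q , q-geo =
    subst (d x z ≤_) (trans (len-++ p q) (cong₂ _+_ p-geo q-geo)) (d-lower x z (p ++ₚ q))

  geodesic-tail : ∀ {x z y} (e : x ∼ z) (p : Path z y) → len (e ∷ p) ≡ d x y → len p ≡ d z y
  geodesic-tail {x} {z} {y} e p geo = ≤-antisym
    (≤-from-diff (diff-nonneg (≤-trans (≤-reflexive geo) (triangle x z y)))
      (solve 3 (λ a b c → a :+ b :- (a :+ c) := b :- c) refl (d x z) (d z y) (len p)))
    (d-lower z y p)

  -- The starting points of the edges, so that the endpoint is left out and the list
  -- of a closed path visits each position of the cycle once.
  vertices : ∀ {a b} → Path a b → List (Fin n)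
  vertices [] = []
  vertices (_∷_ {x} e p) = x ∷ vertices p

  -- The strict inequality records that `u` is not the endpoint `b`; when a geodesic closes up a
  -- cycle, this keeps the closing vertex from occurring twice.
  OnGeodesic : Fin n → Fin n → Fin n → Set
  OnGeodesic a b u = d a u + d u b ≡ d a b × 0# < d u b

  onGeodesic : ∀ {a b} (p : Path a b) → len p ≡ d a b → All (OnGeodesic a b) (vertices p)
  onGeodesic [] geo = []
  onGeodesic {a} {b} (_∷_ {z = z} e p) geo =
    (trans (cong (_+ d a b) (d-refl a)) (+-identityˡ _) , subst (0# <_) geo (0<+ (d-pos (∼⇒≢ e)) 0≤len))
    ∷ All.map shift (onGeodesic p tail-geo)
    where
    tail-geo = geodesic-tail e p geo
    0≤len : 0# ≤ len p
    0≤len = subst (0# ≤_) (sym tail-geo) (d-nonneg z b)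
    shift : ∀ {u} → OnGeodesic z b u → OnGeodesic a b u
    shift {u} (eq , 0<d) = ≤-antisym
      (≤-from-diff (diff-nonneg (triangle a z u)) (begin
        d a z + d z u - d a u                         ≡⟨ solve 4 (λ p q r s → p :+ q :- r := p :+ (q :+ s) :- (r :+ s)) refl (d a z) (d z u) (d a u) (d u b) ⟩
        d a z + (d z u + d u b) - (d a u + d u b)     ≡⟨ cong (λ t → d a z + t - (d a u + d u b)) (trans eq (sym tail-geo)) ⟩
        d a z + len p - (d a u + d u b)               ≡⟨ cong (_- (d a u + d u b)) geo ⟩
        d a b - (d a u + d u b)                       ∎))
      (triangle a u b) , 0<d
      where open ≡-Reasoning

  -- A return to the starting vertex `a` after the step to `z` would give `d a z + d z a ≡ 0#`.
  geodesic-unique : ∀ {a b} (p : Path a b) → len p ≡ d a b → Unique (vertices p)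
  geodesic-unique [] geo = []
  geodesic-unique {a} {b} (_∷_ {z = z} e p) geo =
    All.map distinct (onGeodesic p tail-geo) ∷ geodesic-unique p tail-geo
    where
    tail-geo = geodesic-tail e p geo
    distinct : ∀ {u} → OnGeodesic z b u → ¬ (a ≡ u)
    distinct (eq , _) refl = <-irrefl refl (<-from-diff
      (0<+ (d-pos (∼⇒≢ e)) (d-nonneg z a))
      (begin
        d a z + d z a                     ≡⟨ solve 3 (λ p q r → p :+ q := p :+ (q :+ r) :- r) refl (d a z) (d z a) (d a b) ⟩
        d a z + (d z a + d a b) - d a b   ≡⟨ cong (λ t → d a z + t - d a b) (trans eq (sym tail-geo)) ⟩
        d a z + len p - d a b             ≡⟨ cong (_- d a b) geo ⟩
        d a b - d a b                     ∎))
      where open ≡-Reasoning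

  pathLen-vertices : ∀ {x z y} (e : x ∼ z) (p : Path z y) →
    pathLen RF G (x ∷ vertices p ++ [ y ]) ≡ len (e ∷ p)
  pathLen-vertices e [] = refl
  pathLen-vertices {x} {z} e (e′ ∷ p) = cong (d x z +_) (pathLen-vertices e′ p)

  zip-adjacent : ∀ {x z y} (e : x ∼ z) (p : Path z y) →
    All (AdjPair RF G) (zip (x ∷ vertices p) (vertices p ++ [ y ]))
  zip-adjacent e [] = e ∷ []
  zip-adjacent e (e′ ∷ p) = e ∷ zip-adjacent e′ p

-- Integrals of a harmonic form and the straightening of short walks.

module Homology (RF : RealField) {n : ℕ} (G : WGraph RF n) (isWG : IsWeightedGraph RF G)
  (α : Fin n → Fin n → RealField.R RF) (harmonic : InH₁ RF G α) where

  open Geometry RF G isWG public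
  open Membership (Fin._≟_ {n}) using (_∈?_)

  α-antisym : ∀ {a b} → a ∼ b → α b a ≡ - α a b
  α-antisym {a} {b} = proj₁ harmonic a b

  ∫ : ∀ {a b} → Path a b → R
  ∫ [] = 0#
  ∫ (_∷_ {x} {z} e p) = α x z + ∫ p

  ∫-++ : ∀ {a b c} (p : Path a b) (q : Path b c) → ∫ (p ++ₚ q) ≡ ∫ p + ∫ q
  ∫-++ [] q = sym (+-identityˡ _)
  ∫-++ (_∷_ {x} {z} e p) q = trans (cong (α x z +_) (∫-++ p q)) (sym (+-assoc _ _ _))

  reverse : ∀ {a b} → Path a b → Path b a
  reverse [] = []
  reverse (e ∷ p) = reverse p ++ₚ (∼-sym e ∷ [])

  ∫-reverse : ∀ {a b} (p : Path a b) → ∫ (reverse p) ≡ - ∫ p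
  ∫-reverse [] = solve 0 (con 0ℤ := :- con 0ℤ) refl
  ∫-reverse (_∷_ {x} {z} e p) = begin
    ∫ (reverse p ++ₚ (∼-sym e ∷ []))   ≡⟨ ∫-++ (reverse p) _ ⟩
    ∫ (reverse p) + (α z x + 0#)       ≡⟨ cong₂ (λ s t → s + (t + 0#)) (∫-reverse p) (α-antisym e) ⟩
    - ∫ p + (- α x z + 0#)             ≡⟨ solve 2 (λ s t → :- s :+ (:- t :+ con 0ℤ) := :- (t :+ s)) refl (∫ p) (α x z) ⟩
    - (α x z + ∫ p)                    ∎
    where open ≡-Reasoning

  len-reverse : ∀ {a b} (p : Path a b) → len (reverse p) ≡ len p
  len-reverse [] = refl
  len-reverse (_∷_ {x} {z} e p) = begin
    len (reverse p ++ₚ (∼-sym e ∷ []))   ≡⟨ len-++ (reverse p) _ ⟩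
    len (reverse p) + (d z x + 0#)       ≡⟨ cong₂ (λ s t → s + (t + 0#)) (len-reverse p) (d-sym z x) ⟩
    len p + (d x z + 0#)                 ≡⟨ solve 2 (λ s t → s :+ (t :+ con 0ℤ) := t :+ s) refl (len p) (d x z) ⟩
    d x z + len p                        ∎
    where open ≡-Reasoning

  -- `h` stands for the pattern-matching lambda inside `δ`, which has no name to refer to and is
  -- used only through its values.
  sum-zip : ∀ {h : Fin n × Fin n → R} → (∀ a b → h (a , b) ≡ α a b) →
    ∀ {x z y} (e : x ∼ z) (p : Path z y) →
    sumList RF (map h (zip (x ∷ vertices p) (vertices p ++ [ y ]))) ≡ ∫ (e ∷ p)
  sum-zip h≡α e []       = cong₂ _+_ (h≡α _ _) refl
  sum-zip h≡α e (e′ ∷ p) = cong₂ _+_ (h≡α _ _) (sum-zip h≡α e′ p)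

  ∫-cycle : ∀ {a b} (e : a ∼ b) (p : Path b a) →
    3 ℕ.≤ length (a ∷ vertices p) → Unique (a ∷ vertices p) →
    X₂Labeling RF G (a ∷ vertices p) → ∫ (e ∷ p) ≡ 0#
  ∫-cycle e p long distinct x₂ = trans (sym (sum-zip (λ _ _ → refl) e p))
    (proj₁ (proj₂ harmonic) _ (long , distinct , zip-adjacent e p) x₂)

  ∫-triangle : ∀ {a b c} → a ∼ b → b ∼ c → c ∼ a → α a b + (α b c + (α c a + 0#)) ≡ 0#
  ∫-triangle a∼b b∼c c∼a = ∫-cycle a∼b (b∼c ∷ c∼a ∷ []) (s≤s (s≤s (s≤s z≤n)))
    ((∼⇒≢ a∼b ∷ ∼⇒≢ c∼a ∘ sym ∷ []) ∷ (∼⇒≢ b∼c ∷ []) ∷ [] ∷ []) tt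

  -- q is homologous in M₂(G) to a geodesic, as far as α can see.
  Straightens : ∀ {a b} → Path a b → Set
  Straightens {a} {b} q = ∃ λ (p : Path a b) → len p ≡ d a b × ∫ p ≡ ∫ q

  avoid-end : ∀ {a b} (p : Path b a) → len p ≡ d b a → All (λ u → ¬ (a ≡ u)) (vertices p)
  avoid-end {a} p geo = All.map (λ where (_ , 0<d) refl → <-irrefl (sym (d-refl a)) 0<d) (onGeodesic p geo)

  straighten-by : ∀ {a b} (q : Path a b) (p : Path b a) → len p ≡ d b a → ∫ (q ++ₚ p) ≡ 0# → Straightens q
  straighten-by {a} {b} q p geo closed = reverse p , trans (len-reverse p) (trans geo (d-sym b a)) , (begin
    ∫ (reverse p)             ≡⟨ ∫-reverse p ⟩
    - ∫ p                     ≡⟨ solve 2 (λ p q → :- p := q :- (q :+ p)) refl (∫ p) (∫ q) ⟩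
    ∫ q - (∫ q + ∫ p)         ≡⟨ cong (λ t → ∫ q - t) (trans (sym (∫-++ q p)) closed) ⟩
    ∫ q - 0#                  ≡⟨ solve 1 (λ q → q :- con 0ℤ := q) refl (∫ q) ⟩
    ∫ q                       ∎)
    where open ≡-Reasoning

  straight? : ∀ {a b} (q : Path a b) → Straightens q ⊎ d a b < len q
  straight? {a} {b} q with d-lower a b q
  ... | inj₁ d<len = inj₂ d<len
  ... | inj₂ d≡len = inj₁ (q , sym d≡len , refl)

  -- A strict detour is closed up by a geodesic back from `b` to `a`, which then misses `x`. If the
  -- geodesic is one edge, the result is a triangle. Otherwise its first edge `b ∼ c` serves as the
  -- third edge of the X₂ labeling `a, x, b, c`, and the strict inequality for `d a c` is inherited
  -- from the detour.
  straighten-two : ∀ {a x b} (e : a ∼ x) (f : x ∼ b) → Straightens (e ∷ f ∷ [])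
  straighten-two {a} {x} {b} e f with a Fin.≟ b | straight? (e ∷ f ∷ [])
  ... | yes refl | _ = [] , sym (d-refl a) ,
    sym (trans (cong (λ t → α a x + (t + 0#)) (α-antisym e)) (solve 1 (λ t → t :+ (:- t :+ con 0ℤ) := con 0ℤ) refl (α a x)))
  ... | no _ | inj₁ done = done
  ... | no a≢b | inj₂ detour with geodesic b a
  ...   | p , geo with x ∈? vertices p
  ...     | yes x∈p = ⊥-elim (<-irrefl through detour)
    where
    open ≡-Reasoning
    through : d a b ≡ d a x + (d x b + 0#)
    through = begin
      d a b                     ≡⟨ d-sym a b ⟩
      d b a                     ≡⟨ sym (proj₁ (All.lookup (onGeodesic p geo) x∈p)) ⟩
      d b x + d x a             ≡⟨ cong₂ _+_ (d-sym b x) (d-sym x a) ⟩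
      d x b + d a x             ≡⟨ solve 2 (λ s t → s :+ t := t :+ (s :+ con 0ℤ)) refl (d x b) (d a x) ⟩
      d a x + (d x b + 0#)      ∎
  ...     | no x∉p = straighten-by (e ∷ f ∷ []) p geo (closed p geo
              ((∼⇒≢ e ∷ avoid-end p geo) ∷ ¬Any⇒All¬ _ x∉p ∷ geodesic-unique p geo))
    where
    closed : (p : Path b a) → len p ≡ d b a → Unique (a ∷ x ∷ vertices p) → ∫ (e ∷ f ∷ p) ≡ 0#
    closed [] geo _ = ⊥-elim (a≢b refl)
    closed (g ∷ []) geo _ = ∫-triangle e f g
    closed (_∷_ {z = c} g (h ∷ p)) geo distinct = ∫-cycle e (f ∷ g ∷ h ∷ p) (s≤s (s≤s (s≤s z≤n))) distinct
      (short , trans (pathLen-vertices h p) tail-geo)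
      where
      tail-geo = geodesic-tail g (h ∷ p) geo
      short : d a c < d a x + d x b + d b c
      short = <-from-diff (0<+ (diff-pos detour) (0≤+ (d-nonneg b c) (d-nonneg b c))) (begin
        d a x + (d x b + 0#) - d a b + (d b c + d b c)
          ≡⟨ cong (λ t → d a x + (d x b + 0#) - t + (d b c + d b c)) (trans (d-sym a b) (sym geo)) ⟩
        d a x + (d x b + 0#) - (d b c + len (h ∷ p)) + (d b c + d b c)
          ≡⟨ cong (λ t → d a x + (d x b + 0#) - (d b c + t) + (d b c + d b c)) (trans tail-geo (d-sym c a)) ⟩
        d a x + (d x b + 0#) - (d b c + d a c) + (d b c + d b c)
          ≡⟨ solve 4 (λ p q r s → p :+ (q :+ con 0ℤ) :- (r :+ s) :+ (r :+ r) := p :+ q :+ r :- s) refl (d a x) (d x b) (d b c) (d a c) ⟩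
        d a x + d x b + d b c - d a c ∎)
        where open ≡-Reasoning

  -- In the generic case, closing up by a geodesic gives a cycle of X₂ with `x₃ = b`. The other
  -- cases are the ways in which this can fail: backtracking, a triangle, a walk that is already
  -- geodesic, or a geodesic through `x` or `y`. In the last case the distances to that vertex add
  -- up, so it is enough to straighten the two edges on one side of it.
  straighten-three : ∀ {a x y b} (e : a ∼ x) (f : x ∼ y) (g : y ∼ b) → Straightens (e ∷ f ∷ g ∷ [])
  straighten-three {a} {x} {y} {b} e f g with a Fin.≟ y | x Fin.≟ b | a Fin.≟ b | straight? (e ∷ f ∷ g ∷ [])
  ... | yes refl | _ | _ | _ = g ∷ [] , +-identityʳ _ , sym (trans
          (cong (λ t → α a x + (t + (α y b + 0#))) (α-antisym e))
          (solve 2 (λ s t → s :+ (:- s :+ t) := t) refl (α a x) (α y b + 0#)))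
  ... | no _ | yes refl | _ | _ = e ∷ [] , +-identityʳ _ , sym (trans
          (cong (λ t → α a x + (α x y + (t + 0#))) (α-antisym f))
          (solve 2 (λ s t → s :+ (t :+ (:- t :+ con 0ℤ)) := s :+ con 0ℤ) refl (α a x) (α x y)))
  ... | no _ | no _ | yes refl | _ = [] , sym (d-refl a) , sym (∫-triangle e f g)
  ... | no _ | no _ | no _ | inj₁ done = done
  ... | no a≢y | no x≢b | no a≢b | inj₂ detour with geodesic b a
  ...   | p , geo with x ∈? vertices p
  ...     | yes x∈p = prepend (straighten-two f g)
    where
    open ≡-Reasoning
    prepend : Straightens (f ∷ g ∷ []) → Straightens (e ∷ f ∷ g ∷ [])
    prepend (p′ , geo′ , eq) = e ∷ p′ , (begin
      d a x + len p′      ≡⟨ cong₂ _+_ (d-sym a x) (trans geo′ (d-sym x b)) ⟩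
      d x a + d b x       ≡⟨ +-comm _ _ ⟩
      d b x + d x a       ≡⟨ proj₁ (All.lookup (onGeodesic p geo) x∈p) ⟩
      d b a               ≡⟨ d-sym b a ⟩
      d a b               ∎) , cong (α a x +_) eq
  ...     | no x∉p with y ∈? vertices p
  ...       | yes y∈p = append (straighten-two e f)
    where
    open ≡-Reasoning
    append : Straightens (e ∷ f ∷ []) → Straightens (e ∷ f ∷ g ∷ [])
    append (p′ , geo′ , eq) = p′ ++ₚ (g ∷ []) , (begin
      len (p′ ++ₚ (g ∷ []))    ≡⟨ len-++ p′ (g ∷ []) ⟩
      len p′ + (d y b + 0#)    ≡⟨ cong₂ _+_ (trans geo′ (d-sym a y)) (trans (+-identityʳ _) (d-sym y b)) ⟩
      d y a + d b y            ≡⟨ +-comm _ _ ⟩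
      d b y + d y a            ≡⟨ proj₁ (All.lookup (onGeodesic p geo) y∈p) ⟩
      d b a                    ≡⟨ d-sym b a ⟩
      d a b                    ∎) , (begin
      ∫ (p′ ++ₚ (g ∷ []))              ≡⟨ ∫-++ p′ (g ∷ []) ⟩
      ∫ p′ + (α y b + 0#)              ≡⟨ cong (_+ (α y b + 0#)) eq ⟩
      ∫ (e ∷ f ∷ []) + (α y b + 0#)    ≡⟨ sym (∫-++ (e ∷ f ∷ []) (g ∷ [])) ⟩
      ∫ (e ∷ f ∷ g ∷ [])               ∎)
  ...       | no y∉p = straighten-by (e ∷ f ∷ g ∷ []) p geo (closed p geo
              ((∼⇒≢ e ∷ a≢y ∷ avoid-end p geo) ∷ (∼⇒≢ f ∷ ¬Any⇒All¬ _ x∉p) ∷ ¬Any⇒All¬ _ y∉p ∷ geodesic-unique p geo))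
    where
    open ≡-Reasoning
    closed : (p : Path b a) → len p ≡ d b a → Unique (a ∷ x ∷ y ∷ vertices p) → ∫ (e ∷ f ∷ g ∷ p) ≡ 0#
    closed [] geo _ = ⊥-elim (a≢b refl)
    closed (h ∷ p) geo distinct = ∫-cycle e (f ∷ g ∷ h ∷ p) (s≤s (s≤s (s≤s z≤n))) distinct
      (subst (d a b <_) (solve 3 (λ p q r → p :+ (q :+ (r :+ con 0ℤ)) := p :+ q :+ r) refl (d a x) (d x y) (d y b)) detour
      , trans (pathLen-vertices h p) geo)

  Near : Fin n → Fin n → Set
  Near a b = a ≡ b ⊎ a ∼ b

  near : ∀ {a b} → Near a b → Path a b
  near (inj₁ refl) = []
  near (inj₂ e)    = e ∷ []

  near-sym : ∀ {a b} → Near a b → Near b a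
  near-sym (inj₁ refl) = inj₁ refl
  near-sym (inj₂ e)    = inj₂ (∼-sym e)

  ∫-near-sym : ∀ {a b} (k : Near a b) → ∫ (near (near-sym k)) ≡ - ∫ (near k)
  ∫-near-sym (inj₁ refl) = solve 0 (con 0ℤ := :- con 0ℤ) refl
  ∫-near-sym (inj₂ e) = trans (cong (_+ 0#) (α-antisym e)) (solve 1 (λ t → :- t :+ con 0ℤ := :- (t :+ con 0ℤ)) refl _)

  straighten : ∀ {a x y b} (j : Near a x) (k : Near x y) (l : Near y b) →
    Straightens (near j ++ₚ near k ++ₚ near l)
  straighten {a} (inj₁ refl) (inj₁ refl) (inj₁ refl) = [] , sym (d-refl a) , refl
  straighten (inj₁ refl) (inj₁ refl) (inj₂ g) = g ∷ [] , +-identityʳ _ , refl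
  straighten (inj₁ refl) (inj₂ f) (inj₁ refl) = f ∷ [] , +-identityʳ _ , refl
  straighten (inj₁ refl) (inj₂ f) (inj₂ g)    = straighten-two f g
  straighten (inj₂ e) (inj₁ refl) (inj₁ refl) = e ∷ [] , +-identityʳ _ , refl
  straighten (inj₂ e) (inj₁ refl) (inj₂ g)    = straighten-two e g
  straighten (inj₂ e) (inj₂ f) (inj₁ refl)    = straighten-two e f
  straighten (inj₂ e) (inj₂ f) (inj₂ g)       = straighten-three e f g

-- The Laplacian, Lipschitz extension and the local potential.

module Curvature (RF : RealField) {n : ℕ} (G : WGraph RF n) (isWG : IsWeightedGraph RF G)
  (α : Fin n → Fin n → RealField.R RF) (harmonic : InH₁ RF G α) where

  open Homology RF G isWG α harmonic public

  Laplacian : (Fin n → R) → Fin n → R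
  Laplacian = Δ RF G

  rate : Fin n → Fin n → R
  rate x y = w x y / μ x

  rate-nonneg : ∀ x y → 0# ≤ rate x y
  rate-nonneg x y = 0≤* (w-nonneg x y) (inj₁ (⁻¹-pos (μ-pos x)))

  rate-pos : ∀ {x y} → x ∼ y → 0# < rate x y
  rate-pos {x} x∼y = *-pos x∼y (⁻¹-pos (μ-pos x))

  rate-zero : ∀ {x y} → ¬ (x ∼ y) → rate x y ≡ 0#
  rate-zero {x} {y} x≁y with w-nonneg x y
  ... | inj₁ x∼y = ⊥-elim (x≁y x∼y)
  ... | inj₂ 0≡w = trans (cong (_/ μ x) (sym 0≡w)) (zeroˡ _)

  Laplacian-linear : ∀ c f g x → Laplacian (λ v → f v + c * g v) x ≡ Laplacian f x + c * Laplacian g x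
  Laplacian-linear c f g x = trans
    (∑-cong (λ y → solve 6 (λ r a b a′ b′ c → r :* (a :+ c :* b :- (a′ :+ c :* b′)) := r :* (a :- a′) :+ c :* (r :* (b :- b′)))
      refl (rate x y) (f y) (g y) (f x) (g x) c))
    (∑-linear c (λ y → rate x y * (f y - f x)) (λ y → rate x y * (g y - g x)))

  Laplacian-scale : ∀ c f x → Laplacian (λ v → c * f v) x ≡ c * Laplacian f x
  Laplacian-scale c f x = trans
    (∑-cong (λ y → solve 4 (λ r a a′ c → r :* (c :* a :- c :* a′) := c :* (r :* (a :- a′)))
      refl (rate x y) (f y) (f x) c))
    (∑-scale c (λ y → rate x y * (f y - f x)))

  ∑-rate-cong : ∀ {x} {f g : Fin n → R} → (∀ y → x ∼ y → f y ≡ g y) →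
    ∑ (λ y → rate x y * f y) ≡ ∑ (λ y → rate x y * g y)
  ∑-rate-cong {x} {f} {g} eq = ∑-cong term
    where
    term : ∀ y → rate x y * f y ≡ rate x y * g y
    term y with x ∼? y
    ... | yes x∼y = cong (rate x y *_) (eq y x∼y)
    ... | no x≁y  = trans (trans (cong (_* f y) (rate-zero x≁y)) (zeroˡ _))
                          (sym (trans (cong (_* g y) (rate-zero x≁y)) (zeroˡ _)))

  Lipschitz : R → (Fin n → R) → Set
  Lipschitz σ f = ∀ a b → f b - f a ≤ σ * d a b

  -- f / σ is admissible in the definition of κ(x,y).
  curvature-Lipschitz : ∀ {x y k σ f} → x ∼ y → 0# < σ → Lipschitz σ f → f y - f x ≡ σ * d x y →
    CurvatureAtLeast RF G x y k → k * (σ * d x y) ≤ Laplacian f x - Laplacian f y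
  curvature-Lipschitz {x} {y} {k} {σ} {f} x∼y 0<σ lip slope curved =
    subst (k * (σ * d x y) ≤_) rescale (subst (_≤ (σ * D) * Q) (*-comm _ k)
      (*-monoˡ-≤ (σ * D) (inj₁ (*-pos 0<σ 0<D)) (curved h (unit , bounded , least))))
    where
    open ≡-Reasoning
    D = d x y
    0<D = d-pos (∼⇒≢ x∼y)
    τ = σ ⁻¹
    τσ≡1 : τ * σ ≡ 1#
    τσ≡1 = trans (*-comm τ σ) (⁻¹-inverse σ (>⇒≢0 0<σ))
    h : Fin n → R
    h v = τ * f v
    Q = ∇ RF G x y (Laplacian h)
    h-diff : ∀ a b → h a - h b ≡ τ * (f a - f b)
    h-diff a b = solve 3 (λ t a b → t :* a :- t :* b := t :* (a :- b)) refl τ (f a) (f b)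
    unscale : ∀ t → τ * (σ * t) ≡ t
    unscale t = trans (sym (*-assoc τ σ t)) (trans (cong (_* t) τσ≡1) (*-identityˡ t))
    h-lip : ∀ a b → h a - h b ≤ d a b
    h-lip a b = subst₂ _≤_ (sym (h-diff a b)) (trans (unscale _) (d-sym b a))
      (*-monoˡ-≤ τ (inj₁ (⁻¹-pos 0<σ)) (lip b a))
    bounded : ∀ a b → ¬ (a ≡ b) → abs (∇ RF G a b h) ≤ 1#
    bounded a b a≢b = abs-≤ (/-≤1 (d-pos a≢b) (h-lip a b))
      (subst (_≤ 1#) (solve 3 (λ p q r → (q :- p) :* r := :- ((p :- q) :* r)) refl (h a) (h b) (d a b ⁻¹))
        (/-≤1 (d-pos a≢b) (subst (h b - h a ≤_) (d-sym b a) (h-lip b a))))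
    unit : ∇ RF G y x h ≡ 1#
    unit = begin
      (h y - h x) / d y x     ≡⟨ cong₂ _/_ (trans (h-diff y x) (trans (cong (τ *_) slope) (unscale D))) (d-sym y x) ⟩
      D / D                   ≡⟨ ⁻¹-inverse D (>⇒≢0 0<D) ⟩
      1#                      ∎
    -- The slope 1 is attained at the pair `y, x`, so the norm is exactly 1.
    least : ∀ u → (∀ a b → ¬ (a ≡ b) → abs (∇ RF G a b h) ≤ u) → 1# ≤ u
    least u bound = ≤-trans (subst (_≤ abs (∇ RF G y x h)) unit (≤-abs _)) (bound y x (∼⇒≢ x∼y ∘ sym))
    rescale : (σ * D) * Q ≡ Laplacian f x - Laplacian f y
    rescale = begin
      (σ * D) * Q
        ≡⟨ solve 3 (λ s D q → (s :* D) :* q := s :* (q :* D)) refl σ D Q ⟩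
      σ * (Q * D)
        ≡⟨ cong (σ *_) (/-* _ 0<D) ⟩
      σ * (Laplacian h x - Laplacian h y)
        ≡⟨ cong (σ *_) (cong₂ _-_ (Laplacian-scale τ f x) (Laplacian-scale τ f y)) ⟩
      σ * (τ * Laplacian f x - τ * Laplacian f y)
        ≡⟨ solve 4 (λ s t a b → s :* (t :* a :- t :* b) := t :* (s :* (a :- b))) refl σ τ _ _ ⟩
      τ * (σ * (Laplacian f x - Laplacian f y))
        ≡⟨ unscale _ ⟩
      Laplacian f x - Laplacian f y ∎

  -- The extension is the lower envelope of the cones `h i + σ * d i v` with apex in `B`. It turns a
  -- function controlled only near an edge into a competitor in the global definition of κ.
  McShane : ∀ {B : Fin n → Set} (B? : Decidable B) → ∃ B → ∀ {σ} (h : Fin n → R) → 0# ≤ σ →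
    (∀ a b → B a → B b → h b - h a ≤ σ * d a b) →
    ∃ λ f → (∀ b → B b → f b ≡ h b) × Lipschitz σ f
  McShane {B} B? some {σ} h 0≤σ lip = f , agrees , f-lip
    where
    cone : Fin n → Fin n → R
    cone v i = h i + σ * d i v
    apex : Fin n → Fin n
    apex v = proj₁ (argmin B? (cone v) some)
    apex∈B : ∀ v → B (apex v)
    apex∈B v = proj₁ (proj₂ (argmin B? (cone v) some))
    apex-least : ∀ v j → B j → cone v (apex v) ≤ cone v j
    apex-least v = proj₂ (proj₂ (argmin B? (cone v) some))
    f : Fin n → R
    f v = cone v (apex v)
    agrees : ∀ b → B b → f b ≡ h b
    agrees b b∈B = ≤-antisym
      (subst (f b ≤_)
        (trans (cong (λ t → h b + σ * t) (d-refl b)) (solve 2 (λ h s → h :+ s :* con 0ℤ := h) refl (h b) σ))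
        (apex-least b b b∈B))
      (≤-from-diff (diff-nonneg (lip (apex b) b (apex∈B b) b∈B))
        (solve 3 (λ b i t → t :- (b :- i) := i :+ t :- b) refl (h b) (h (apex b)) (σ * d (apex b) b)))
    f-lip : Lipschitz σ f
    f-lip a b = ≤-from-diff
      (0≤+ (diff-nonneg (apex-least b i (apex∈B a))) (diff-nonneg (*-monoˡ-≤ σ 0≤σ (triangle i a b))))
      (solve 6 (λ hi s ib ia ab c → (hi :+ s :* ib :- c) :+ (s :* (ia :+ ab) :- s :* ib) := s :* ab :- (c :- (hi :+ s :* ia)))
        refl (h i) σ (d i b) (d i a) (d a b) (f b))
      where i = apex a

  near? : ∀ a b → Dec (Near a b)
  near? a b = (a Fin.≟ b) ⊎-dec (a ∼? b)

  -- Proofs of adjacency need not be unique, but the integral sees only the endpoints.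
  ∫-near-irrelevant : ∀ {a b} (j k : Near a b) → ∫ (near j) ≡ ∫ (near k)
  ∫-near-irrelevant (inj₁ refl) (inj₁ refl) = refl
  ∫-near-irrelevant (inj₁ refl) (inj₂ e)    = ⊥-elim (∼⇒≢ e refl)
  ∫-near-irrelevant (inj₂ e)    (inj₁ refl) = ⊥-elim (∼⇒≢ e refl)
  ∫-near-irrelevant (inj₂ e)    (inj₂ e′)   = refl

  -- F is a potential of α on Ball only; its value 0 elsewhere is never used.
  module Potential {x y} (x∼y : x ∼ y) where

    Ball : Fin n → Set
    Ball v = Near x v ⊎ Near y v

    Ball? : Decidable Ball
    Ball? v = near? x v ⊎-dec near? y v

    F : Fin n → R
    F v with near? x v | near? y v
    ... | yes k | _    = ∫ (near k)
    ... | no _ | yes l = α x y + ∫ (near l)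
    ... | no _ | no _  = 0#

    F-left : ∀ {v} (k : Near x v) → F v ≡ ∫ (near k)
    F-left {v} k with near? x v | near? y v
    ... | yes k′ | _ = ∫-near-irrelevant k′ k
    ... | no ¬k | _  = ⊥-elim (¬k k)

    -- Consistency of the two branches of `F`: the routes to `v` from `x` directly and through `y`
    -- differ by a backtrack or by a triangle, and α vanishes on both.
    ∫-via-edge : ∀ {v} (k : Near x v) (l : Near y v) → ∫ (near k) ≡ α x y + ∫ (near l)
    ∫-via-edge (inj₁ refl) (inj₁ refl) = ⊥-elim (∼⇒≢ x∼y refl)
    ∫-via-edge (inj₁ refl) (inj₂ _) = sym (trans (cong (λ t → α x y + (t + 0#)) (α-antisym x∼y))
      (solve 1 (λ t → t :+ (:- t :+ con 0ℤ) := con 0ℤ) refl (α x y)))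
    ∫-via-edge (inj₂ _) (inj₁ refl) = refl
    ∫-via-edge {v} (inj₂ x∼v) (inj₂ y∼v) = begin
      α x v + 0#
        ≡⟨ cong (α x v +_) (sym (∫-triangle x∼y y∼v (∼-sym x∼v))) ⟩
      α x v + (α x y + (α y v + (α v x + 0#)))
        ≡⟨ cong (λ t → α x v + (α x y + (α y v + (t + 0#)))) (α-antisym x∼v) ⟩
      α x v + (α x y + (α y v + (- α x v + 0#)))
        ≡⟨ solve 3 (λ p q r → p :+ (q :+ (r :+ (:- p :+ con 0ℤ))) := q :+ (r :+ con 0ℤ)) refl (α x v) (α x y) (α y v) ⟩
      α x y + (α y v + 0#) ∎
      where open ≡-Reasoning

    F-right : ∀ {v} (l : Near y v) → F v ≡ α x y + ∫ (near l)
    F-right {v} l with near? x v | near? y v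
    ... | yes k | _ = ∫-via-edge k l
    ... | no _ | yes l′ = cong (α x y +_) (∫-near-irrelevant l′ l)
    ... | no _ | no ¬l = ⊥-elim (¬l l)

    -- The route from `a` to its centre, possibly across the edge, and on to `b` has at most three
    -- edges, so it straightens. Bounds on α along geodesics thereby become bounds on differences of
    -- `F`.
    F-geodesic : ∀ {a b} → Ball a → Ball b → ∃ λ (p : Path a b) → len p ≡ d a b × ∫ p ≡ F b - F a
    F-geodesic {a} {b} a∈ b∈ = via a∈ b∈
      where
      open ≡-Reasoning
      connect : ∀ {u v} (k : Near u a) (m : Near u v) (l : Near v b) {t} →
        - ∫ (near k) + (∫ (near m) + ∫ (near l)) ≡ t → ∃ λ (p : Path a b) → len p ≡ d a b × ∫ p ≡ t
      connect k m l {t} eq with straighten (near-sym k) m l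
      ... | p , geo , ∫≡ = p , geo , (begin
        ∫ p                                                          ≡⟨ ∫≡ ⟩
        ∫ (near (near-sym k) ++ₚ near m ++ₚ near l)                  ≡⟨ ∫-++ (near (near-sym k)) _ ⟩
        ∫ (near (near-sym k)) + ∫ (near m ++ₚ near l)                ≡⟨ cong₂ _+_ (∫-near-sym k) (∫-++ (near m) _) ⟩
        - ∫ (near k) + (∫ (near m) + ∫ (near l))                     ≡⟨ eq ⟩
        t                                                            ∎)
      via : Ball a → Ball b → ∃ λ (p : Path a b) → len p ≡ d a b × ∫ p ≡ F b - F a
      via (inj₁ k) (inj₁ l) = connect k (inj₁ refl) l (begin
        - ∫ (near k) + (0# + ∫ (near l))   ≡⟨ solve 2 (λ k l → :- k :+ (con 0ℤ :+ l) := l :- k) refl _ _ ⟩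
        ∫ (near l) - ∫ (near k)            ≡⟨ sym (cong₂ _-_ (F-left l) (F-left k)) ⟩
        F b - F a                          ∎)
      via (inj₁ k) (inj₂ l) = connect k (inj₂ x∼y) l (begin
        - ∫ (near k) + (α x y + 0# + ∫ (near l))   ≡⟨ solve 3 (λ k l a → :- k :+ (a :+ con 0ℤ :+ l) := a :+ l :- k) refl _ _ _ ⟩
        α x y + ∫ (near l) - ∫ (near k)            ≡⟨ sym (cong₂ _-_ (F-right l) (F-left k)) ⟩
        F b - F a                                  ∎)
      via (inj₂ k) (inj₁ l) = connect k (inj₂ (∼-sym x∼y)) l (begin
        - ∫ (near k) + (α y x + 0# + ∫ (near l))   ≡⟨ cong (λ t → - ∫ (near k) + (t + 0# + ∫ (near l))) (α-antisym x∼y) ⟩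
        - ∫ (near k) + (- α x y + 0# + ∫ (near l)) ≡⟨ solve 3 (λ k l a → :- k :+ (:- a :+ con 0ℤ :+ l) := l :- (a :+ k)) refl _ _ _ ⟩
        ∫ (near l) - (α x y + ∫ (near k))          ≡⟨ sym (cong₂ _-_ (F-left l) (F-right k)) ⟩
        F b - F a                                  ∎)
      via (inj₂ k) (inj₂ l) = connect k (inj₁ refl) l (begin
        - ∫ (near k) + (0# + ∫ (near l))                    ≡⟨ solve 3 (λ k l a → :- k :+ (con 0ℤ :+ l) := a :+ l :- (a :+ k)) refl _ _ (α x y) ⟩
        α x y + ∫ (near l) - (α x y + ∫ (near k))           ≡⟨ sym (cong₂ _-_ (F-right l) (F-right k)) ⟩
        F b - F a                                           ∎)

    F-x : F x ≡ 0#
    F-x = F-left (inj₁ refl)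

    F-y : F y ≡ α x y
    F-y = trans (F-left (inj₂ x∼y)) (+-identityʳ _)

    Laplacian-F-x : Laplacian F x ≡ 0#
    Laplacian-F-x = trans (∑-rate-cong step) (proj₂ (proj₂ harmonic) x)
      where
      step : ∀ v → x ∼ v → F v - F x ≡ α x v
      step v x∼v = trans (cong₂ _-_ (F-left (inj₂ x∼v)) F-x)
        (solve 1 (λ t → t :+ con 0ℤ :- con 0ℤ := t) refl (α x v))

    Laplacian-F-y : Laplacian F y ≡ 0#
    Laplacian-F-y = trans (∑-rate-cong step) (proj₂ (proj₂ harmonic) y)
      where
      step : ∀ v → y ∼ v → F v - F y ≡ α y v
      step v y∼v = trans (cong₂ _-_ (F-right (inj₂ y∼v)) F-y)
        (solve 2 (λ s t → s :+ (t :+ con 0ℤ) :- s := t) refl (α x y) (α y v))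

  -- Perturbing the potential along extremal edges.

  module Extremal (s : R) (0<s : 0# < s) (α≤ : ∀ {a b} → a ∼ b → α a b ≤ s * d a b) where

    infix 4 _⇝_ _⇝?_
    _⇝_ : Fin n → Fin n → Set
    a ⇝ b = a ∼ b × α a b ≡ s * d a b

    _⇝?_ : ∀ a b → Dec (a ⇝ b)
    a ⇝? b = (a ∼? b) ×-dec (α a b ≟ s * d a b)

    -- The rate is 0 for the constant function and for the indicator used below, and 1 for the
    -- length of a longest extremal path.
    Decreasing : R → (Fin n → R) → Set
    Decreasing c g = ∀ a b → a ⇝ b → c * d a b ≤ g a - g b

    -- One edge of slope below `s` makes the whole inequality strict; otherwise every edge is
    -- extremal and the drops of `g` telescope.
    calibrate : ∀ {c g} → Decreasing c g → ∀ {a b} (p : Path a b) →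
      ∫ p < s * len p ⊎ (∫ p ≡ s * len p × c * len p ≤ g a - g b)
    calibrate {c} {g} dec {a} [] = inj₂ (sym (zeroʳ s) ,
      inj₂ (solve 2 (λ c g → c :* con 0ℤ := g :- g) refl c (g a)))
    calibrate {c} {g} dec {a} {b} (_∷_ {z = z} e p) with α≤ e | calibrate dec p
    ... | inj₁ lt | inj₁ lt′ = inj₁ (subst (α a z + ∫ p <_) (sym (distribˡ s _ _)) (+-mono-<-≤ lt (inj₁ lt′)))
    ... | inj₁ lt | inj₂ (eq , _) = inj₁ (subst (α a z + ∫ p <_) (sym (distribˡ s _ _)) (+-mono-<-≤ lt (inj₂ eq)))
    ... | inj₂ eq | inj₁ lt = inj₁ (subst (α a z + ∫ p <_) (sym (distribˡ s _ _)) (+-mono-≤-< (inj₂ eq) lt))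
    ... | inj₂ eq | inj₂ (eq′ , drop) = inj₂ (trans (cong₂ _+_ eq eq′) (sym (distribˡ s _ _)) ,
      subst₂ _≤_ (sym (distribˡ c _ _))
        (solve 3 (λ a z b → a :- z :+ (z :- b) := a :- b) refl (g a) (g z) (g b))
        (+-mono-≤ (dec a z (e , eq)) drop))

    -- For small `ε`, `F + ε g` is Lipschitz on the balls with constant `s - ε * c`: a geodesic with
    -- strict slack absorbs the perturbation, and along an extremal one `g` drops by at least `c`
    -- times the length. Equality on the edge makes the new constant attained there. Since `F` is
    -- harmonic at both ends, only the Laplacians of `g` survive.
    curvature-perturb : ∀ {x y k c g} → x ⇝ y → Decreasing c g → c * d x y ≡ g x - g y →
      CurvatureAtLeast RF G x y k →
      ∃ λ ε → 0# < ε × ∃ λ σ → 0# < σ × k * (σ * d x y) ≤ ε * (Laplacian g x - Laplacian g y)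
    curvature-perturb {x} {y} {k} {c} {g} (x∼y , tight) dec drop curved =
      ε , 0<ε , σ , 0<σ , subst (k * (σ * d x y) ≤_) Laplacian-f
        (curvature-Lipschitz x∼y 0<σ f-lip slope curved)
      where
      open ≡-Reasoning
      open Potential x∼y
      Good : R → Fin n → Fin n → Set
      Good η a b = F b - F a + η * (g b - g a) ≤ s * d a b - η * (c * d a b)
      good : ∀ a b → Ball a → Ball b → Eventually (λ η → Good η a b)
      good a b a∈ b∈ with F-geodesic a∈ b∈
      ... | p , geo , ∫≡ with calibrate dec p
      ...   | inj₁ lt with eventually-* (g b - g a + c * d a b) (diff-pos (subst₂ _<_ ∫≡ (cong (s *_) geo) lt))
      ...     | ε , 0<ε , q = ε , 0<ε , λ η 0<η η≤ → ≤-from-diff (diff-nonneg (q η 0<η η≤))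
        (solve 5 (λ S f g C e → S :- f :- e :* (g :+ C) := S :- e :* C :- (f :+ e :* g)) refl
           (s * d a b) (F b - F a) (g b - g a) (c * d a b) η)
      good a b a∈ b∈ | p , geo , ∫≡ | inj₂ (eq , le) = 1# , 0<1 , λ η 0<η _ →
        ≤-from-diff (*-monoˡ-nonneg η 0<η) (begin
          η * (g a - g b - c * len p)
            ≡⟨ cong (λ t → η * (g a - g b - c * t)) geo ⟩
          η * (g a - g b - c * d a b)
            ≡⟨ solve 5 (λ e ga gb C S → e :* (ga :- gb :- C) := S :- e :* C :- (S :+ e :* (gb :- ga)))
                 refl η (g a) (g b) (c * d a b) (s * d a b) ⟩
          s * d a b - η * (c * d a b) - (s * d a b + η * (g b - g a))
            ≡⟨ cong (λ t → s * d a b - η * (c * d a b) - (t + η * (g b - g a)))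
                 (trans (cong (s *_) (sym geo)) (trans (sym eq) ∫≡)) ⟩
          s * d a b - η * (c * d a b) - (F b - F a + η * (g b - g a)) ∎)
        where
        *-monoˡ-nonneg : ∀ η → 0# < η → 0# ≤ η * (g a - g b - c * len p)
        *-monoˡ-nonneg η 0<η = 0≤* (inj₁ 0<η) (diff-nonneg le)
      -- Doubling `c` keeps `ε * c` at most half of `s`, so the weak inequality still yields a
      -- strictly positive `σ`.
      small : Eventually (λ η → η * (c + c) ≤ s × (∀ a b → Ball a → Ball b → Good η a b))
      small = both (eventually-* (c + c) 0<s)
        (allFin λ a → allFin λ b → when (Ball? a) λ a∈ → when (Ball? b) λ b∈ → good a b a∈ b∈)
      ε = proj₁ small
      0<ε = proj₁ (proj₂ small)
      σ = s - ε * c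
      0<σ : 0# < σ
      0<σ = ≰⇒> λ σ≤0 → <-irrefl refl (<-≤-trans 0<s (≤-from-diff
        (0≤+ (0≤+ (diff-nonneg σ≤0) (diff-nonneg σ≤0)) (diff-nonneg (proj₁ (proj₂ (proj₂ small) ε 0<ε ≤-refl))))
        (solve 3 (λ s e c → con 0ℤ :- (s :- e :* c) :+ (con 0ℤ :- (s :- e :* c)) :+ (s :- e :* (c :+ c)) := con 0ℤ :- s) refl s ε c)))
      h : Fin n → R
      h v = F v + ε * g v
      h-lip : ∀ a b → Ball a → Ball b → h b - h a ≤ σ * d a b
      h-lip a b a∈ b∈ = subst₂ _≤_
        (solve 5 (λ f f′ g g′ e → f :- f′ :+ e :* (g :- g′) := f :+ e :* g :- (f′ :+ e :* g′)) refl (F b) (F a) (g b) (g a) ε)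
        (solve 4 (λ s d e c → s :* d :- e :* (c :* d) := (s :- e :* c) :* d) refl s (d a b) ε c)
        (proj₂ (proj₂ (proj₂ small) ε 0<ε ≤-refl) a b a∈ b∈)
      extension = McShane Ball? (x , inj₁ (inj₁ refl)) h (inj₁ 0<σ) h-lip
      f = proj₁ extension
      f≡h = proj₁ (proj₂ extension)
      f-lip = proj₂ (proj₂ extension)
      f≡h-x : f x ≡ h x
      f≡h-x = f≡h x (inj₁ (inj₁ refl))
      f≡h-y : f y ≡ h y
      f≡h-y = f≡h y (inj₂ (inj₁ refl))
      slope : f y - f x ≡ σ * d x y
      slope = begin
        f y - f x                                     ≡⟨ cong₂ _-_ f≡h-y f≡h-x ⟩
        F y + ε * g y - (F x + ε * g x)               ≡⟨ cong₂ (λ s t → s + ε * g y - (t + ε * g x)) (trans F-y tight) F-x ⟩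
        s * d x y + ε * g y - (0# + ε * g x)          ≡⟨ solve 4 (λ a e p q → a :+ e :* q :- (con 0ℤ :+ e :* p) := a :- e :* (p :- q)) refl (s * d x y) ε (g x) (g y) ⟩
        s * d x y - ε * (g x - g y)                   ≡⟨ cong (λ t → s * d x y - ε * t) (sym drop) ⟩
        s * d x y - ε * (c * d x y)                   ≡⟨ solve 4 (λ s d e c → s :* d :- e :* (c :* d) := (s :- e :* c) :* d) refl s (d x y) ε c ⟩
        σ * d x y                                     ∎
      Laplacian-h : ∀ v → f v ≡ h v → (∀ u → v ∼ u → Ball u) → Laplacian F v ≡ 0# → Laplacian f v ≡ ε * Laplacian g v
      Laplacian-h v fv≡ in-ball harm = begin
        Laplacian f v                       ≡⟨ ∑-rate-cong (λ u v∼u → cong₂ _-_ (f≡h u (in-ball u v∼u)) fv≡) ⟩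
        Laplacian h v                       ≡⟨ Laplacian-linear ε F g v ⟩
        Laplacian F v + ε * Laplacian g v   ≡⟨ cong (_+ ε * Laplacian g v) harm ⟩
        0# + ε * Laplacian g v              ≡⟨ +-identityˡ _ ⟩
        ε * Laplacian g v                   ∎
      Laplacian-f : Laplacian f x - Laplacian f y ≡ ε * (Laplacian g x - Laplacian g y)
      Laplacian-f = trans
        (cong₂ _-_ (Laplacian-h x f≡h-x (λ u → inj₁ ∘ inj₂) Laplacian-F-x)
                   (Laplacian-h y f≡h-y (λ u → inj₂ ∘ inj₂) Laplacian-F-y))
        (solve 3 (λ e p q → e :* p :- e :* q := e :* (p :- q)) refl ε _ _)

    Laplacian-zero : ∀ v → Laplacian (λ _ → 0#) v ≡ 0#
    Laplacian-zero v = trans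
      (∑-cong (λ u → solve 1 (λ r → r :* (con 0ℤ :- con 0ℤ) := con 0ℤ :* r) refl (rate v u)))
      (trans (∑-scale 0# (rate v)) (zeroˡ _))

    -- With `g` and `c` zero the perturbation is trivial: the right side vanishes while
    -- `k * (σ * d x y)` is positive.
    positive-curvature : ∀ {x y} → CurvaturePositive RF G x y → ¬ (x ⇝ y)
    positive-curvature {x} {y} (k , 0<k , curved) x⇝y =
      absurd (curvature-perturb {c = 0#} {g = λ _ → 0#} x⇝y
               (λ a b _ → inj₂ (constant a b)) (constant x y) curved)
      where
      constant : ∀ a b → 0# * d a b ≡ 0# - 0#
      constant a b = solve 1 (λ t → con 0ℤ :* t := con 0ℤ :- con 0ℤ) refl (d a b)
      vanishes : ∀ ε → ε * (Laplacian (λ _ → 0#) x - Laplacian (λ _ → 0#) y) ≡ 0#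
      vanishes ε = trans (cong (ε *_) (cong₂ _-_ (Laplacian-zero x) (Laplacian-zero y)))
        (solve 1 (λ e → e :* (con 0ℤ :- con 0ℤ) := con 0ℤ) refl ε)
      absurd : ¬ (∃ λ ε → 0# < ε × ∃ λ σ → 0# < σ ×
        k * (σ * d x y) ≤ ε * (Laplacian (λ _ → 0#) x - Laplacian (λ _ → 0#) y))
      absurd (ε , _ , σ , 0<σ , le) = ≤⇒≯ (subst (k * (σ * d x y) ≤_) (vanishes ε) le)
        (*-pos 0<k (*-pos 0<σ (d-pos (∼⇒≢ (proj₁ x⇝y)))))

    nonneg-curvature : ∀ {x y c g} → x ⇝ y → Decreasing c g → c * d x y ≡ g x - g y →
      CurvatureAtLeast RF G x y 0# → Laplacian g y ≤ Laplacian g x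
    nonneg-curvature {x} {y} {c} {g} x⇝y dec drop curved =
      conclude (curvature-perturb {g = g} x⇝y dec drop curved)
      where
      conclude : (∃ λ ε → 0# < ε × ∃ λ σ → 0# < σ ×
        0# * (σ * d x y) ≤ ε * (Laplacian g x - Laplacian g y)) → Laplacian g y ≤ Laplacian g x
      conclude (ε , 0<ε , σ , _ , le) = ≤-from-diff {e = Laplacian g x - Laplacian g y}
        (*-cancelˡ-≤ ε 0<ε (subst (_≤ ε * (Laplacian g x - Laplacian g y)) (trans (zeroˡ _) (sym (zeroʳ ε))) le))
        refl

-- Extremal paths and the vanishing of the form.

module Vanishing (RF : RealField) {n : ℕ} (G : WGraph RF n) (isWG : IsWeightedGraph RF G)
  (α : Fin n → Fin n → RealField.R RF) (harmonic : InH₁ RF G α) where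

  open Curvature RF G isWG α harmonic

  -- Excluded middle holds under double negation at each vertex, and finitely many double negations
  -- can be exchanged with the quantifier.
  ¬¬-decidable : (P : Fin n → Set) → ¬ ¬ Decidable P
  ¬¬-decidable P = Fin.sequence (RawMonad.rawApplicative ¬¬-Monad) (λ _ → ¬¬-excluded-middle)

  drop-nonpos : ∀ {g : Fin n → R} {v} → (∀ u → v ∼ u → g u ≤ g v) → ∀ u → rate v u * (g u - g v) ≤ 0#
  drop-nonpos {g} {v} max u with v ∼? u
  ... | yes v∼u = ≤-from-diff (0≤* (rate-nonneg v u) (diff-nonneg (max u v∼u)))
    (solve 3 (λ r a b → r :* (b :- a) := con 0ℤ :- r :* (a :- b)) refl (rate v u) (g u) (g v))
  ... | no v≁u = inj₂ (trans (cong (_* (g u - g v)) (rate-zero v≁u)) (zeroˡ _))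

  Laplacian-nonneg : ∀ {g : Fin n → R} {v} → (∀ u → v ∼ u → g v ≤ g u) → 0# ≤ Laplacian g v
  Laplacian-nonneg {g} {v} min = ∑-nonneg term
    where
    term : ∀ u → 0# ≤ rate v u * (g u - g v)
    term u with v ∼? u
    ... | yes v∼u = 0≤* (rate-nonneg v u) (diff-nonneg (min u v∼u))
    ... | no v≁u  = inj₂ (sym (trans (cong (_* (g u - g v)) (rate-zero v≁u)) (zeroˡ _)))

  Laplacian-neg : ∀ {g : Fin n → R} {v u} → (∀ u → v ∼ u → g u ≤ g v) → v ∼ u → g u < g v → Laplacian g v < 0#
  Laplacian-neg {g} {v} {u} max v∼u gu<gv = ∑-neg (drop-nonpos {g} max) u
    (<-from-diff (*-pos (rate-pos v∼u) (diff-pos gu<gv))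
      (solve 3 (λ r a b → r :* (b :- a) := con 0ℤ :- r :* (a :- b)) refl (rate v u) (g u) (g v)))

  Laplacian-neg⁻¹ : ∀ {g : Fin n → R} {v} → Laplacian g v < 0# → ∃ λ u → v ∼ u × g u < g v
  Laplacian-neg⁻¹ {g} {v} neg with Fin.any? (λ u → (v ∼? u) ×-dec (g u <? g v))
  ... | yes found = found
  ... | no none = ⊥-elim (≤⇒≯ (Laplacian-nonneg {g} (λ u v∼u → ≮⇒≥ (λ lt → none (u , v∼u , lt)))) neg)

  closed-everywhere : ∀ {P : Fin n → Set} → (∀ {a b} → P a → a ∼ b → P b) → ∀ {a b} → Path a b → P a → P b
  closed-everywhere step [] p = p
  closed-everywhere step (e ∷ q) p = closed-everywhere step q (step p e)

  module Propagation (connected : Connected RF G) (nonneg : NonNegOllivier RF G)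
    (s : R) (0<s : 0# < s) (α≤ : ∀ {a b} → a ∼ b → α a b ≤ s * d a b) where
    open Extremal s 0<s α≤

    _⇜_ : Fin n → Fin n → Set
    b ⇜ a = a ⇝ b

    Laplacian-antitone : ∀ {x y c g} → x ⇝ y → Decreasing c g → c * d x y ≡ g x - g y → Laplacian g y ≤ Laplacian g x
    Laplacian-antitone {x} {y} x⇝y dec drop = nonneg-curvature x⇝y dec drop (nonneg x y (proj₁ x⇝y))

    -- If there are no infinite extremal paths, then the length of a longest extremal path
    -- from a vertex is subharmonic, hence constant; but it drops along extremal edges.
    module LongestPath (wf : WellFounded _⇜_) where

      -- The default 0 is the length of the empty path, the right value at a vertex without extremal
      -- successors.
      continue : ∀ v → WfRec _⇜_ (λ _ → R) v → Fin n → R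
      continue v rec u with v ⇝? u
      ... | yes e = d v u + rec e
      ... | no _  = 0#

      -- Replaces function extensionality when the well-founded recursion defining `L` is unfolded.
      continue-cong : ∀ v {rec rec′ : WfRec _⇜_ (λ _ → R) v} →
        (∀ {u} (e : v ⇝ u) → rec e ≡ rec′ e) → ∀ u → continue v rec u ≡ continue v rec′ u
      continue-cong v eq u with v ⇝? u
      ... | yes e = cong (d v u +_) (eq e)
      ... | no _  = refl

      longest : ∀ v → WfRec _⇜_ (λ _ → R) v → R
      longest v rec = ⨆ (continue v rec)

      L : Fin n → R
      L = WF.All.wfRec wf 0ℓ (λ _ → R) longest

      L-unfold : ∀ v → L v ≡ ⨆ (continue v (λ {u} _ → L u))
      L-unfold v = FixPoint.unfold-wfRec wf (λ _ → R) longest (λ v eq → ⨆-cong (continue-cong v eq))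

      L-nonneg : ∀ v → 0# ≤ L v
      L-nonneg v = subst (0# ≤_) (sym (L-unfold v)) (⨆-nonneg (continue v (λ {u} _ → L u)))

      L-continue : ∀ {v u} → v ⇝ u → d v u + L u ≤ L v
      L-continue {v} {u} e = subst₂ _≤_ value (sym (L-unfold v)) (⨆-upper (continue v (λ {u} _ → L u)) u)
        where
        value : continue v (λ {u} _ → L u) u ≡ d v u + L u
        value with v ⇝? u
        ... | yes _ = refl
        ... | no ¬e = ⊥-elim (¬e e)

      L-attained : ∀ v → L v ≡ 0# ⊎ ∃ λ u → v ⇝ u × L v ≡ d v u + L u
      L-attained v with ⨆-attained (continue v (λ {u} _ → L u))
      ... | inj₁ eq = inj₁ (trans (L-unfold v) eq)
      ... | inj₂ (u , eq) = value (trans (L-unfold v) eq)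
        where
        value : L v ≡ continue v (λ {u} _ → L u) u → L v ≡ 0# ⊎ ∃ λ u → v ⇝ u × L v ≡ d v u + L u
        value eq with v ⇝? u
        ... | yes e = inj₂ (u , e , eq)
        ... | no _  = inj₁ eq

      L-decreasing : Decreasing 1# L
      L-decreasing a b e = ≤-from-diff (diff-nonneg (L-continue e))
        (solve 3 (λ d a b → a :- (d :+ b) := a :- b :- con 1ℤ :* d) refl (d a b) (L a) (L b))

      -- Where `L` is 0 it has a global minimum. Elsewhere a longest path starts with some `v ⇝ u`
      -- on which `L` drops by exactly `d v u`, so curvature passes the inequality from `u` back to
      -- `v`.
      L-subharmonic : ∀ v → 0# ≤ Laplacian L v
      L-subharmonic = WF.All.wfRec wf 0ℓ _ λ v rec → step v rec (L-attained v)
        where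
        step : ∀ v → WfRec _⇜_ (λ u → 0# ≤ Laplacian L u) v →
          L v ≡ 0# ⊎ (∃ λ u → v ⇝ u × L v ≡ d v u + L u) → 0# ≤ Laplacian L v
        step v rec (inj₁ eq) = Laplacian-nonneg {L} (λ u _ → subst (_≤ L u) (sym eq) (L-nonneg u))
        step v rec (inj₂ (u , e , eq)) = ≤-trans (rec e) (Laplacian-antitone {g = L} e L-decreasing
          (sym (trans (cong (_- L u) eq) (solve 2 (λ d l → d :+ l :- l := con 1ℤ :* d) refl (d v u) (L u)))))

      no-extremal : ∀ {a b} → ¬ (a ⇝ b)
      no-extremal {a} {b} e with argmax {P = λ _ → ⊤} (λ _ → yes tt) L (a , tt)
      ... | m , _ , max = <-irrefl (trans (constant b) (sym (constant a)))
              (<-≤-trans (<-from-diff (d-pos (∼⇒≢ (proj₁ e)))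
                (solve 2 (λ d l → d := d :+ l :- l) refl (d a b) (L b))) (L-continue e))
        where
        constant : ∀ v → L v ≡ L m
        constant v = closed-everywhere {λ v → L v ≡ L m} step (connected m v) refl
          where
          step : ∀ {u v} → L u ≡ L m → u ∼ v → L v ≡ L m
          step {u} {v} eq u∼v = trans (≤-antisym (below u v u∼v eq) (≮⇒≥ λ lt →
            ≤⇒≯ (L-subharmonic u) (Laplacian-neg {L} (λ w u∼w → below u w u∼w eq) u∼v lt))) eq
            where
            below : ∀ u w → u ∼ w → L u ≡ L m → L w ≤ L u
            below u w _ eq = subst (L w ≤_) (sym eq) (max w tt)

    -- Vertices from which all extremal paths terminate.

    -- Accessibility for the reversed relation is the inductive form of the absence of infinite
    -- extremal paths.
    A : Fin n → Set
    A = Acc _⇜_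

    -- All extremal paths from v are finite, and no vertex on them is adjacent to the start
    -- of an infinite one.
    data Tame (v : Fin n) : Set where
      tame : A v → (∀ {u} → v ∼ u → A u) → (∀ {u} → v ⇝ u → Tame u) → Tame v

    module _ (A? : Decidable A) (Tame? : Decidable Tame) where

      -- An infinite extremal path is never built as a whole; it is followed one step at a time
      -- outside `A`.
      successor : ∀ {v} → ¬ A v → ∃ λ u → v ⇝ u × ¬ A u
      successor {v} ¬Av with Fin.any? (λ u → (v ⇝? u) ×-dec ¬? (A? u))
      ... | yes found = found
      ... | no none = ⊥-elim (¬Av (acc λ {u} e → decidable-stable (A? u) (λ ¬Au → none (u , e , ¬Au))))

      module _ {z} (Az : A z) (tame-below : ∀ {u} → z ⇝ u → Tame u) where

        -- Adding the tame vertices to `z` makes the set closed under extremal steps, so that `-𝟙`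
        -- never increases along them. Among its members only `z` can have a neighbour outside `A`.
        U : Fin n → Set
        U v = v ≡ z ⊎ Tame v

        U? : Decidable U
        U? v = (v Fin.≟ z) ⊎-dec Tame? v

        U⊆A : ∀ {v} → U v → A v
        U⊆A (inj₁ refl) = Az
        U⊆A (inj₂ (tame Av _ _)) = Av

        U-closed : ∀ {a b} → a ⇝ b → U a → U b
        U-closed e (inj₁ refl) = inj₂ (tame-below e)
        U-closed e (inj₂ (tame _ _ below)) = inj₂ (below e)

        -𝟙 : Fin n → R
        -𝟙 v with U? v
        ... | yes _ = - 1#
        ... | no _  = 0#

        -1<0 : - 1# < 0#
        -1<0 = <-from-diff 0<1 (solve 0 (con 1ℤ := con 0ℤ :- :- con 1ℤ) refl)

        -𝟙-in : ∀ {v} → U v → -𝟙 v ≡ - 1#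
        -𝟙-in {v} Uv with U? v
        ... | yes _  = refl
        ... | no ¬Uv = ⊥-elim (¬Uv Uv)

        -𝟙-out : ∀ {v} → ¬ U v → -𝟙 v ≡ 0#
        -𝟙-out {v} ¬Uv with U? v
        ... | yes Uv = ⊥-elim (¬Uv Uv)
        ... | no _   = refl

        -𝟙-nonpos : ∀ v → -𝟙 v ≤ 0#
        -𝟙-nonpos v with U? v
        ... | yes _ = inj₁ -1<0
        ... | no _  = ≤-refl

        -𝟙-decreasing : Decreasing 0# -𝟙
        -𝟙-decreasing a b e = subst (_≤ -𝟙 a - -𝟙 b) (sym (zeroˡ _)) (diff-nonneg (antitone (U? a)))
          where
          antitone : Dec (U a) → -𝟙 b ≤ -𝟙 a
          antitone (yes Ua) = inj₂ (trans (-𝟙-in (U-closed e Ua)) (sym (-𝟙-in Ua)))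
          antitone (no ¬Ua) = subst (-𝟙 b ≤_) (sym (-𝟙-out ¬Ua)) (-𝟙-nonpos b)

        -- `-𝟙` takes its maximum 0 at both ends of the edge, and the neighbour `z` makes its
        -- Laplacian negative at `v`. Curvature makes it negative at `v′` as well, so `v′` has a
        -- neighbour in `U`; a tame one would put `v′` in `A`, which leaves `z`.
        adjacency-persists : ∀ {v v′} → ¬ A v → ¬ A v′ → v ⇝ v′ → z ∼ v → z ∼ v′
        adjacency-persists {v} {v′} ¬Av ¬Av′ e z∼v = meets (Laplacian-neg⁻¹ { -𝟙} (≤-<-trans
          (Laplacian-antitone {c = 0#} e -𝟙-decreasing level) negative))
          where
          -𝟙v≡0 = -𝟙-out (¬Av ∘ U⊆A)
          -𝟙v′≡0 = -𝟙-out (¬Av′ ∘ U⊆A)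
          level : 0# * d v v′ ≡ -𝟙 v - -𝟙 v′
          level = trans (solve 1 (λ d → con 0ℤ :* d := con 0ℤ :- con 0ℤ) refl (d v v′))
            (sym (cong₂ _-_ -𝟙v≡0 -𝟙v′≡0))
          negative : Laplacian -𝟙 v < 0#
          negative = Laplacian-neg { -𝟙} (λ u _ → subst (-𝟙 u ≤_) (sym -𝟙v≡0) (-𝟙-nonpos u)) (∼-sym z∼v)
            (subst₂ _<_ (sym (-𝟙-in (inj₁ refl))) (sym -𝟙v≡0) -1<0)
          meets : (∃ λ u → v′ ∼ u × -𝟙 u < -𝟙 v′) → z ∼ v′
          meets (u , v′∼u , lt) with U? u
          ... | yes (inj₁ refl) = ∼-sym v′∼u
          ... | yes (inj₂ (tame _ adjacent _)) = ⊥-elim (¬Av′ (adjacent (∼-sym v′∼u)))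
          ... | no ¬Uu = ⊥-elim (<-irrefl (sym -𝟙v′≡0) lt)

        -- The triangle `z, v, v′` lies in X₂, so the increment of `α z` is the extremal value
        -- `s * d v v′`.
        α-increases : ∀ {v v′} → v ⇝ v′ → z ∼ v → z ∼ v′ → α z v < α z v′
        α-increases {v} {v′} (v∼v′ , tight) z∼v z∼v′ = <-from-diff (*-pos 0<s (d-pos (∼⇒≢ v∼v′))) (begin
          s * d v v′
            ≡⟨ sym tight ⟩
          α v v′
            ≡⟨ solve 3 (λ p q r → q := p :+ (q :+ (:- r :+ con 0ℤ)) :+ r :- p) refl (α z v) (α v v′) (α z v′) ⟩
          α z v + (α v v′ + (- α z v′ + 0#)) + α z v′ - α z v
            ≡⟨ cong (λ t → t + α z v′ - α z v) (trans (cong (λ t → α z v + (α v v′ + (t + 0#))) (sym (α-antisym z∼v′)))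
                 (∫-triangle z∼v v∼v′ (∼-sym z∼v′))) ⟩
          0# + α z v′ - α z v
            ≡⟨ cong (_- α z v) (+-identityˡ _) ⟩
          α z v′ - α z v ∎)
          where open ≡-Reasoning

        -- Among the neighbours of z on infinite extremal paths, one maximising α z v would have
        -- a successor that is again a neighbour of z, with a larger value.
        adjacent-acc : ∀ {v} → z ∼ v → A v
        adjacent-acc {v} z∼v = decidable-stable (A? v) λ ¬Av → absurd
          (argmax (λ u → (z ∼? u) ×-dec ¬? (A? u)) (α z) (v , z∼v , ¬Av))
          where
          absurd : ¬ (∃ λ m → (z ∼ m × ¬ A m) × (∀ u → z ∼ u × ¬ A u → α z u ≤ α z m))
          absurd (m , (z∼m , ¬Am) , max) with successor ¬Am
          ... | m′ , e , ¬Am′ = ≤⇒≯ (max m′ (z∼m′ , ¬Am′)) (α-increases e z∼m z∼m′)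
            where z∼m′ = adjacency-persists ¬Am ¬Am′ e z∼m

      -- Recursion on accessibility makes all successors of `z` tame before `z` is treated, as the
      -- construction of `U` requires.
      acc⇒tame : ∀ {z} → A z → Tame z
      acc⇒tame Az@(acc rs) = tame Az (adjacent-acc Az (λ e → acc⇒tame (rs e))) (λ e → acc⇒tame (rs e))

      acc-closed : ∀ {a b} → A a → a ∼ b → A b
      acc-closed Aa a∼b with acc⇒tame Aa
      ... | tame _ adjacent _ = adjacent a∼b

      extremal-everywhere : ∀ {a b} → a ⇝ b → ∀ x → ∃ λ y → x ⇝ y
      extremal-everywhere {a} {b} e x with A? x
      ... | no ¬Ax = proj₁ (successor ¬Ax) , proj₁ (proj₂ (successor ¬Ax))
      ... | yes Ax = ⊥-elim (LongestPath.no-extremal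
              (λ v → closed-everywhere acc-closed (connected x v) Ax) e)

  -- Conclusion from the maximal slope.

  module _ (connected : Connected RF G) (nonneg : NonNegOllivier RF G)
    {x} (positive : ∀ y → x ∼ y → CurvaturePositive RF G x y) where

    α-zero : ∀ a b → a ∼ b → α a b ≡ 0#
    -- Pairs are coded in `Fin (n * n)` so that `argmax` over one index applies; the given edge
    -- makes the search set nonempty.
    α-zero a b a∼b = conclude (argmax adjacent? ratio (combine a b , at {λ (u , v) → u ∼ v} a∼b))
      where
      at : ∀ {P : Fin n × Fin n → Set} {u v} → P (u , v) → P (remQuot n (combine u v))
      at {P} {u} {v} = subst P (sym (Fin.remQuot-combine u v))
      pair : Fin (n ℕ.* n) → Fin n × Fin n
      pair = remQuot {n} n
      Adjacent : Fin (n ℕ.* n) → Set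
      Adjacent i = let u , v = pair i in u ∼ v
      adjacent? : Decidable Adjacent
      adjacent? i = let u , v = pair i in u ∼? v
      ratio : Fin (n ℕ.* n) → R
      ratio i = let u , v = pair i in α u v / d u v
      conclude : (∃ λ i → Adjacent i × (∀ j → Adjacent j → ratio j ≤ ratio i)) → α a b ≡ 0#
      conclude (i , p∼q , max) = decide (0# <? s)
        where
        p = proj₁ (pair i)
        q = proj₂ (pair i)
        s = ratio i
        α≤ : ∀ {u v} → u ∼ v → α u v ≤ s * d u v
        α≤ {u} {v} u∼v = subst₂ _≤_ (trans (*-comm _ _) (/-* (α u v) 0<d)) (*-comm _ s)
          (*-monoˡ-≤ (d u v) (inj₁ 0<d) (subst (λ (u , v) → α u v / d u v ≤ s) (Fin.remQuot-combine u v)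
            (max (combine u v) (at {λ (u , v) → u ∼ v} u∼v))))
          where 0<d = d-pos (∼⇒≢ u∼v)
        decide : Dec (0# < s) → α a b ≡ 0#
        -- A contradiction is sought here, so `A` and `Tame` may be taken as decidable although no
        -- decision procedure is given.
        decide (yes 0<s) = ⊥-elim (¬¬-decidable A λ A? → ¬¬-decidable Tame λ Tame? →
          contradiction (extremal-everywhere A? Tame? (p∼q , sym (/-* (α p q) (d-pos (∼⇒≢ p∼q)))) x))
          where
          open Propagation connected nonneg s 0<s α≤
          open Extremal s 0<s α≤ using (_⇝_; positive-curvature)
          contradiction : ¬ (∃ λ y → x ⇝ y)
          contradiction (y , e) = positive-curvature (positive y (proj₁ e)) e
        -- A maximal slope that is not positive bounds α by 0 on both orientations of the edge, and
        -- antisymmetry leaves only 0.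
        decide (no s≯0) = ≤-antisym (nonpos a∼b)
          (subst (0# ≤_) (-‿involutive _) (subst (_≤ - - α a b) (solve 0 (:- con 0ℤ := con 0ℤ) refl)
            (neg-≤ (subst (_≤ 0#) (α-antisym a∼b) (nonpos (∼-sym a∼b))))))
          where
          nonpos : ∀ {u v} → u ∼ v → α u v ≤ 0#
          nonpos {u} {v} u∼v = ≤-trans (α≤ u∼v) (subst₂ _≤_ (*-comm _ s) (zeroʳ _)
            (*-monoˡ-≤ (d u v) (d-nonneg u v) (≮⇒≥ s≯0)))

theorem3p5 : (RF : RealField) (n : ℕ) (G : WGraph RF n) →
    IsWeightedGraph RF G → Connected RF G → NonNegOllivier RF G →
    (x : Fin n) → (∀ y → Adj RF G x y → CurvaturePositive RF G x y) →
    BettiOneZero RF G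
theorem3p5 RF n G isWG connected nonneg x positive α harmonic =
  Vanishing.α-zero RF G isWG α harmonic connected nonneg positive
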